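{- The alternation depth of languages definable in $FO^2[<,\mathrm{Inv}]$ is unbounded: for every $d$ there is a finite alphabet and a language over it definable in $FO^2[<,\mathrm{Inv}]$ whose alternation depth exceeds $d$. If $|A|=2$, then every language $L\subseteq A^*$ definable in $FO^2[<,\mathrm{Inv}]$ has alternation depth at most $3$.
   Context: $FO[<]$ is first-order logic over finite words with $<$ and unary letter predicates $a(x)$; $\Sigma_k[<]$ denotes the sentences of $FO[<]$ in prenex form with $k$ alternating blocks of quantifiers beginning with an existential block (arbitrarily many variables allowed). The alternation depth of a language $L$ definable in $FO[<]$ is the smallest $k$ such that $L$ is definable by a boolean combination of $\Sigma_k[<]$ sentences. $FO^2[<,\mathrm{Inv}]$ is two-variable first-order logic with $<$, $a(x)$, and binary predicates $a(x,y)$ meaning that $a$ occurs strictly between positions $x$ and $y$. -}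

module Defs where

open import Data.Fin using (Fin; zero; suc; _<_)
open import Data.Fin.Subset using (Subset; Side; inside; outside; _∈_) renaming (⊥ to ∅)
open import Data.List using (List; length; lookup)
open import Data.Nat using (ℕ; zero; suc) renaming (_<_ to _<ℕ_; _≤_ to _≤ℕ_)
open import Data.Product using (Σ-syntax; ∃-syntax; _×_)
open import Data.Sum using (_⊎_)
open import Data.Unit using (⊤; tt)
open import Data.Vec using (Vec; []; _∷_; _[_]≔_; here; there) renaming (lookup to _at_)
open import Data.Vec.Relation.Unary.All using (All; []; _∷_)
open import Level using (0ℓ)
open import Relation.Binary.PropositionalEquality using (_≡_)
open import Relation.Nullary using (¬_)
open import Relation.Unary using (Pred; _≐_)

Language : Set → Set₁
Language A = Pred (List A) 0ℓ

-- A word is a structure whose domain is its set of positions; the empty word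
-- is included, with empty domain.
Pos : {A : Set} → List A → Set
Pos w = Fin (length w)

infix  9 _≺_ _≈_
infixr 7 _∧_
infixr 6 _∨_

-- n bounds the free variables (de Bruijn indices).
data FO[<] (A : Set) (n : ℕ) : Set where
  _≺_ _≈_ : (x y : Fin n) → FO[<] A n
  letter  : (a : A) (x : Fin n) → FO[<] A n
  true    : FO[<] A n
  not     : FO[<] A n → FO[<] A n
  _∧_ _∨_ : (φ ψ : FO[<] A n) → FO[<] A n
  ∃′ ∀′   : FO[<] A (suc n) → FO[<] A n

-- Γ is the set of variables in scope.  Variables are names, not de Bruijn
-- indices: there are only the two names of Fin 2, and a quantifier may rebind
-- a name already in scope, after which its previous value is inaccessible.
data FO²[<,Inv] (A : Set) (Γ : Subset 2) : Set where
  _≺_ _≈_ : ∀ {x y} → x ∈ Γ → y ∈ Γ → FO²[<,Inv] A Γ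
  letter  : ∀ {x} → A → x ∈ Γ → FO²[<,Inv] A Γ
  between : ∀ {x y} → A → x ∈ Γ → y ∈ Γ → FO²[<,Inv] A Γ
  true    : FO²[<,Inv] A Γ
  not     : FO²[<,Inv] A Γ → FO²[<,Inv] A Γ
  _∧_ _∨_ : (φ ψ : FO²[<,Inv] A Γ) → FO²[<,Inv] A Γ
  ∃′ ∀′   : (x : Fin 2) → FO²[<,Inv] A (Γ [ x ]≔ inside) → FO²[<,Inv] A Γ

module _ {A : Set} where

  Sat : ∀ {n} (w : List A) → Vec (Pos w) n → FO[<] A n → Set
  Sat w ρ (x ≺ y)      = ρ at x < ρ at y
  Sat w ρ (x ≈ y)      = ρ at x ≡ ρ at y
  Sat w ρ (letter a x) = lookup w (ρ at x) ≡ a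
  Sat w ρ true         = ⊤
  Sat w ρ (not φ)      = ¬ Sat w ρ φ
  Sat w ρ (φ ∧ ψ)      = Sat w ρ φ × Sat w ρ ψ
  Sat w ρ (φ ∨ ψ)      = Sat w ρ φ ⊎ Sat w ρ ψ
  Sat w ρ (∃′ φ)       = Σ[ i ∈ Pos w ] Sat w (i ∷ ρ) φ
  Sat w ρ (∀′ φ)       = (i : Pos w) → Sat w (i ∷ ρ) φ

  Slot : List A → Side → Set
  Slot w inside  = Pos w
  Slot w outside = ⊤

  Env : ∀ {n} → List A → Subset n → Set
  Env w Γ = All (Slot w) Γ

  value : ∀ {n w} {Γ : Subset n} {x} → Env w Γ → x ∈ Γ → Pos w
  value (i ∷ _) here      = i
  value (_ ∷ ρ) (there p) = value ρ p

  assign : ∀ {n w} {Γ : Subset n} → Env w Γ → (x : Fin n) → Pos w → Env w (Γ [ x ]≔ inside)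
  assign (_ ∷ ρ) zero    i = i ∷ ρ
  assign (s ∷ ρ) (suc x) i = s ∷ assign ρ x i

  Sat² : ∀ {Γ} (w : List A) → Env w Γ → FO²[<,Inv] A Γ → Set
  Sat² w ρ (x ≺ y)         = value ρ x < value ρ y
  Sat² w ρ (x ≈ y)         = value ρ x ≡ value ρ y
  Sat² w ρ (letter a x)    = lookup w (value ρ x) ≡ a
  Sat² w ρ (between a x y) = Σ[ z ∈ Pos w ] (value ρ x < z × z < value ρ y × lookup w z ≡ a)
  Sat² w ρ true            = ⊤
  Sat² w ρ (not φ)         = ¬ Sat² w ρ φ
  Sat² w ρ (φ ∧ ψ)         = Sat² w ρ φ × Sat² w ρ ψ
  Sat² w ρ (φ ∨ ψ)         = Sat² w ρ φ ⊎ Sat² w ρ ψ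
  Sat² w ρ (∃′ x φ)        = Σ[ i ∈ Pos w ] Sat² w (assign ρ x i) φ
  Sat² w ρ (∀′ x φ)        = (i : Pos w) → Sat² w (assign ρ x i) φ

  ⟦_⟧ : FO[<] A 0 → Language A
  ⟦ φ ⟧ w = Sat w [] φ

  ⟦_⟧² : FO²[<,Inv] A ∅ → Language A
  ⟦ φ ⟧² w = Sat² w (tt ∷ tt ∷ []) φ

  data QuantifierFree {n} : FO[<] A n → Set where
    _≺_ _≈_ : ∀ x y → QuantifierFree (x ≺ y)
    letter  : ∀ a x → QuantifierFree (letter a x)
    true    : QuantifierFree true
    not     : ∀ {φ} → QuantifierFree φ → QuantifierFree (not φ)
    _∧_     : ∀ {φ ψ} → QuantifierFree φ → QuantifierFree ψ → QuantifierFree (φ ∧ ψ)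
    _∨_     : ∀ {φ ψ} → QuantifierFree φ → QuantifierFree ψ → QuantifierFree (φ ∨ ψ)

  -- Prenex formulas with k alternating blocks, the outermost existential
  -- (IsΣ) or universal (IsΠ).  A block may have any length, including zero, so
  -- that the levels are cumulative; level 0 is the quantifier-free formulas.
  mutual
    data IsΣ {n} : ℕ → FO[<] A n → Set where
      qf    : ∀ {φ} → QuantifierFree φ → IsΣ 0 φ
      block : ∀ {k φ} → IsΠ k φ → IsΣ (suc k) φ
      ∃′    : ∀ {k φ} → IsΣ (suc k) φ → IsΣ (suc k) (∃′ φ)

    data IsΠ {n} : ℕ → FO[<] A n → Set where
      qf    : ∀ {φ} → QuantifierFree φ → IsΠ 0 φ
      block : ∀ {k φ} → IsΣ k φ → IsΠ (suc k) φ
      ∀′    : ∀ {k φ} → IsΠ (suc k) φ → IsΠ (suc k) (∀′ φ)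

  data IsBΣ (k : ℕ) : FO[<] A 0 → Set where
    base : ∀ {φ} → IsΣ k φ → IsBΣ k φ
    not  : ∀ {φ} → IsBΣ k φ → IsBΣ k (not φ)
    _∧_  : ∀ {φ ψ} → IsBΣ k φ → IsBΣ k ψ → IsBΣ k (φ ∧ ψ)
    _∨_  : ∀ {φ ψ} → IsBΣ k φ → IsBΣ k ψ → IsBΣ k (φ ∨ ψ)

  DefinableFO : Language A → Set
  DefinableFO L = ∃[ φ ] L ≐ ⟦ φ ⟧

  DefinableFO² : Language A → Set
  DefinableFO² L = ∃[ φ ] L ≐ ⟦ φ ⟧²

  DefinableBΣ : ℕ → Language A → Set
  DefinableBΣ k L = ∃[ φ ] (IsBΣ k φ × L ≐ ⟦ φ ⟧)

  -- The alternation depth of an FO[<]-definable L is the minimum of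
  -- { k | DefinableBΣ k L }.  Constructively a minimum need not be computable,
  -- so upper and lower bounds on it are spelled out instead.
  AlternationDepth≤ : Language A → ℕ → Set
  AlternationDepth≤ L d = ∃[ k ] (DefinableBΣ k L × k ≤ℕ d)

  AlternationDepth> : Language A → ℕ → Set
  AlternationDepth> L d = DefinableFO L × (∀ k → DefinableBΣ k L → d <ℕ k)

module Submission where

-- Lower bound.  Members of level k + 1 are words cut into blocks by the letter
-- k + 1, some block of which is not a member of level k; "the block after x is
-- a member of level k" is expressible with two variables, since the letters
-- above k between x and y tell whether y lies in that block.  If v ≤ u in the
-- game with k alternations, then u^N ≤ u^N v u^N in the game with k + 1
-- alternations for large N; iterating this with u and v built from members and
-- nonmembers gives words that d alternations cannot separate.
--
-- Upper bound.  Over two letters a formula is equivalent to a modal one whose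
-- modalities look at the neighbouring position, along a run of one letter, or
-- at positions beyond an occurrence of each letter.  The last modality is
-- monotone in the current position, so it is a comparison with one threshold
-- position, and the thresholds can be guessed existentially.  What remains is
-- local: deep inside a run without thresholds it does not depend on the
-- position.  Hence a universal quantifier over a run reduces to finitely many
-- positions near landmarks, and local properties are Σ₂ together with their
-- complements.  Guessing the thresholds and verifying them is then Σ₃.

open import Defs
open import Data.Bool using (Bool; true; false)
open import Data.Empty using (⊥; ⊥-elim)
open import Data.Fin using (Fin; zero; suc; toℕ; _<_; _↑ˡ_; _↑ʳ_)
open import Data.Fin.Induction using (<-wellFounded; >-wellFounded)
open import Data.Fin.Properties using (<-irrefl; <-asym; <-trans; <-cmp; toℕ-injective; toℕ≤pred[n]; any?; all?; ¬∀⟶∃¬)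
  renaming (_≟_ to _≟ᶠ_; _<?_ to _<ᶠ?_)
open import Data.Fin.Subset using (Subset; inside; outside; _∈_)
open import Data.List using (List; []; _∷_; _++_; length; lookup)
open import Data.List.Properties using (++-assoc; ++-identityʳ; ∷-injective)
open import Data.Nat using (ℕ; zero; suc; _+_; _∸_; _⊔_; z≤n; s≤s; _≤′_; ≤′-refl; ≤′-step)
  renaming (_<_ to _<ℕ_; _≤_ to _≤ℕ_; _<?_ to _<ℕ?_)
import Data.Nat.Properties as ℕₚ
open import Data.Product using (Σ-syntax; ∃-syntax; _×_; _,_; proj₁; proj₂)
open import Data.Product.Function.NonDependent.Propositional using (_×-⇔_)
open import Data.Sum using (_⊎_; inj₁; inj₂; [_,_]′)
open import Data.Sum.Function.Propositional using (_⊎-⇔_)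
open import Data.Unit using (⊤; tt)
open import Data.Vec using (Vec; []; _∷_; _[_]≔_; here; there; tail) renaming (lookup to _at_; _++_ to _++ᵛ_)
open import Data.Vec.Relation.Unary.All using ([]; _∷_)
open import Function using (case_of_)
open import Function.Bundles using (_⇔_; mk⇔; Equivalence; _↔_; Inverse)
open import Function.Construct.Composition using (_⇔-∘_)
open import Function.Construct.Symmetry using (⇔-sym)
open import Induction.WellFounded using (WellFounded; Acc; acc)
open import Relation.Binary.Definitions using (DecidableEquality; tri<; tri≈; tri>)
open import Relation.Binary.PropositionalEquality using (_≡_; _≢_; refl; sym; trans; cong; cong₂; subst; subst₂)
open import Relation.Nullary using (¬_; Dec; yes; no; contradiction; ¬?; _×-dec_; _⊎-dec_)
open import Relation.Nullary.Decidable using (map′; decidable-stable)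
open Equivalence using (to; from)

-- The one-sidedness of the game comes from the insertion step: going from `v ≤ u` to
-- `u^N ≤ u^N v u^N` exchanges the sides of `u` and `v`, and each new level pays for this exchange
-- with one change of word. After the change Spoiler may play inside the inserted `v`, and there the
-- assumption supplies the answers. The size of the alphabet enters the upper bound at one point.
-- Over two letters, the interval between two positions either misses a letter, and then is empty or
-- a run, or contains both, a condition that survives enlarging the interval. With three letters,
-- "contains a and b but not c" is no longer monotone, and one threshold does not describe the
-- positions from which it can be met. Nesting does not raise the level because thresholds determine
-- truth instead of merely certifying it: for all parameters that satisfy their Π₂ condition, a
-- modal formula and its negation are both read off the parameters. So the thresholds of all
-- subformulas are guessed in one block. This is why a local property has to come with Σ₂
-- definitions of itself and of its complement.

private variable
  A : Set
  k m n q : ℕ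
  u v w s t u′ v′ s′ t′ : List A
  a : A

-- Congruence of logical equivalence.

⇔-refl : {P : Set} → P ⇔ P
⇔-refl = mk⇔ (λ p → p) (λ p → p)

¬-⇔ : {P Q : Set} → P ⇔ Q → (¬ P) ⇔ (¬ Q)
¬-⇔ h = mk⇔ (λ n q → n (from h q)) (λ n p → n (to h p))

∃-⇔ : {I : Set} {P Q : I → Set} → (∀ i → P i ⇔ Q i) → (Σ[ i ∈ I ] P i) ⇔ (Σ[ i ∈ I ] Q i)
∃-⇔ h = mk⇔ (λ { (i , p) → i , to (h i) p }) (λ { (i , p) → i , from (h i) p })

∀-⇔ : {I : Set} {P Q : I → Set} → (∀ i → P i ⇔ Q i) → ((i : I) → P i) ⇔ ((i : I) → Q i)
∀-⇔ h = mk⇔ (λ f i → to (h i) (f i)) (λ f i → from (h i) (f i))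

≡⇒⇔ : {P Q : Set} → P ≡ Q → P ⇔ Q
≡⇒⇔ refl = ⇔-refl

-- The one-sided game and its closure properties.

-- The Ehrenfeucht–Fraïssé game with q moves in which Spoiler starts in the
-- first word and may change words k times.  A move cuts both words at the same
-- letter, and the game continues on the two pairs of factors independently.
data Game {A : Set} : ℕ → ℕ → List A → List A → Set

Forth : {A : Set} → (List A → List A → Set) → List A → List A → Set
Forth R u v = ∀ s a t → u ≡ s ++ a ∷ t →
  ∃[ s′ ] ∃[ t′ ] (v ≡ s′ ++ a ∷ t′ × R s s′ × R t t′)

data Game where
  stop : Game k 0 u v
  last : Forth (Game 0 q) u v → Game 0 (suc q) u v
  move : Forth (Game (suc k) q) u v → Game k (suc q) v u → Game (suc k) (suc q) u v

forth : Game k (suc q) u v → Forth (Game k q) u v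
forth (last f) = f
forth (move f _) = f

switch : Game (suc k) q u v → Game k q v u
switch stop = stop
switch (move _ g) = g

-- Merges `last` and `move`: the reversed game is demanded only when a change of word is left, so
-- later proofs need no case distinction on `k`.
game : ∀ k → (∀ {k′} → k ≡ suc k′ → Game k′ (suc q) v u) → Forth (Game k q) u v → Game k (suc q) u v
game zero    g f = last f
game (suc k) g f = move f (g refl)

game-refl : ∀ k q (u : List A) → Game k q u u
game-refl k       zero    u = stop
game-refl zero    (suc q) u = last λ s a t e → s , t , e , game-refl zero q s , game-refl zero q t
game-refl (suc k) (suc q) u =
  move (λ s a t e → s , t , e , game-refl (suc k) q s , game-refl (suc k) q t) (game-refl k (suc q) u)

game-trans : ∀ k q {u v w : List A} → Game k q u v → Game k q v w → Game k q u w
game-trans k zero g h = stop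
game-trans k (suc q) g h = game k
  (λ { {k′} refl → game-trans k′ (suc q) (switch h) (switch g) })
  λ s a t e → let s′ , t′ , e′ , g₁ , g₂ = forth g s a t e
                  s″ , t″ , e″ , h₁ , h₂ = forth h s′ a t′ e′
              in s″ , t″ , e″ , game-trans k q g₁ h₁ , game-trans k q g₂ h₂

game-pred : ∀ k q {u v : List A} → Game k (suc q) u v → Game k q u v
game-pred k zero g = stop
game-pred k (suc q) g = game k
  (λ { {k′} refl → game-pred k′ (suc q) (switch g) })
  λ s a t e → let s′ , t′ , e′ , g₁ , g₂ = forth g s a t e
              in s′ , t′ , e′ , game-pred k q g₁ , game-pred k q g₂

++-split : ∀ (u : List A) {v s a t} → u ++ v ≡ s ++ a ∷ t →
  (∃[ t′ ] (u ≡ s ++ a ∷ t′ × t ≡ t′ ++ v)) ⊎ (∃[ s′ ] (s ≡ u ++ s′ × v ≡ s′ ++ a ∷ t))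
++-split []      {s = s} e = inj₂ (s , refl , e)
++-split (x ∷ u) {s = []} refl = inj₁ (u , refl , refl)
++-split (x ∷ u) {s = y ∷ s} e with ∷-injective e
... | refl , e′ with ++-split u e′
... | inj₁ (t′ , refl , p) = inj₁ (t′ , refl , p)
... | inj₂ (s′ , refl , p) = inj₂ (s′ , refl , p)

-- A cut of a concatenation falls into one of the two factors and is answered there. The other
-- factor is left whole and merely loses a move.
game-++ : ∀ k q {u v u′ v′ : List A} → Game k q u v → Game k q u′ v′ → Game k q (u ++ u′) (v ++ v′)
game-++ k zero g h = stop
game-++ k (suc q) {u} {v} {u′} {v′} g h = game k
  (λ { {k′} refl → game-++ k′ (suc q) (switch g) (switch h) })
  λ s a t e → case ++-split u e of λ where
    (inj₁ (t₁ , e₁ , refl)) →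
      let s′ , t′ , e′ , g₁ , g₂ = forth g s a t₁ e₁
      in s′ , t′ ++ v′ , trans (cong (_++ v′) e′) (++-assoc s′ (a ∷ t′) v′)
         , g₁ , game-++ k q g₂ (game-pred k q h)
    (inj₂ (s₁ , refl , e₁)) →
      let s′ , t′ , e′ , h₁ , h₂ = forth h s₁ a t e₁
      in v ++ s′ , t′ , trans (cong (v ++_) e′) (sym (++-assoc v s′ (a ∷ t′)))
         , game-++ k q (game-pred k q g) h₁ , h₂

-- Powers with large exponents, and insertion into them.

pow : ℕ → List A → List A
pow zero    u = []
pow (suc n) u = u ++ pow n u

pow-+ : ∀ i j (u : List A) → pow (i + j) u ≡ pow i u ++ pow j u
pow-+ zero    j u = refl
pow-+ (suc i) j u = trans (cong (u ++_) (pow-+ i j u)) (sym (++-assoc u (pow i u) (pow j u)))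

pow-split : ∀ n (u : List A) {s a t} → pow n u ≡ s ++ a ∷ t →
  ∃[ i ] ∃[ j ] ∃[ u₁ ] ∃[ u₂ ] (i + suc j ≡ n × u ≡ u₁ ++ a ∷ u₂ × s ≡ pow i u ++ u₁ × t ≡ u₂ ++ pow j u)
pow-split zero u {[]} ()
pow-split zero u {_ ∷ _} ()
pow-split (suc n) u e with ++-split u e
... | inj₁ (t′ , e₁ , e₂) = 0 , n , _ , t′ , refl , e₁ , refl , e₂
... | inj₂ (s′ , e₁ , e₂) with pow-split n u e₂
... | i , j , u₁ , u₂ , p , r , refl , e₄ =
  suc i , j , u₁ , u₂ , cong suc p , r , trans e₁ (sym (++-assoc u (pow i u) u₁)) , e₄

-- From `large q` on, exponents cannot be told apart with q quantifiers.
large : ℕ → ℕ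
large zero    = 0
large (suc q) = suc (large q + large q)

Close : ℕ → ℕ → ℕ → Set
Close q m n = m ≡ n ⊎ (large q ≤ℕ m × large q ≤ℕ n)

close-sym : ∀ {q m n} → Close q m n → Close q n m
close-sym (inj₁ e) = inj₁ (sym e)
close-sym (inj₂ (x , y)) = inj₂ (y , x)

private
  remainder : ∀ {N i n} → i ≤ℕ N → suc (N + N) ≤ℕ n → ∃[ j ] (i + suc j ≡ n × N ≤ℕ j)
  remainder {N} {i} {n} i≤N p = n ∸ suc i , e , ℕₚ.≤-trans (ℕₚ.≤-reflexive (sym (ℕₚ.m+n∸m≡n i N)))
      (ℕₚ.≤-trans (ℕₚ.∸-monoˡ-≤ i (ℕₚ.+-monoˡ-≤ N i≤N)) (ℕₚ.∸-monoˡ-≤ (suc i) p))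
    where
    i<n : suc i ≤ℕ n
    i<n = ℕₚ.≤-trans (s≤s (ℕₚ.≤-trans i≤N (ℕₚ.m≤m+n N N))) p
    e : i + suc (n ∸ suc i) ≡ n
    e = trans (ℕₚ.+-suc i _) (ℕₚ.m+[n∸m]≡n i<n)

  remainder′ : ∀ {N i j n} → i ≤ℕ N → suc (N + N) ≤ℕ n → i + suc j ≡ n → N ≤ℕ j
  remainder′ {i = i} i≤N p refl with remainder i≤N p
  ... | j′ , e , r with ℕₚ.suc-injective (ℕₚ.+-cancelˡ-≡ i _ _ e)
  ... | refl = r

  flip-sum : ∀ {i j n} → i + suc j ≡ n → j + suc i ≡ n
  flip-sum {i} {j} e = trans (ℕₚ.+-suc j i) (trans (cong suc (ℕₚ.+-comm j i)) (trans (sym (ℕₚ.+-suc i j)) e))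

-- With N = `large q`, the bound 2N + 1 leaves room for the block that is cut and N blocks on either
-- side. If `i` or `j` is at most N it is copied exactly, and the opposite exponent is then at least
-- N in both words; if both are at least N, the reply is the split with N blocks on the left.
close-split : ∀ q {m n i j} → Close (suc q) m n → i + suc j ≡ m →
  ∃[ i′ ] ∃[ j′ ] (i′ + suc j′ ≡ n × Close q i i′ × Close q j j′)
close-split q {i = i} {j} (inj₁ refl) e = i , j , e , inj₁ refl , inj₁ refl
close-split q {i = i} {j} (inj₂ (x , y)) e with ℕₚ.≤-total i (large q) | ℕₚ.≤-total j (large q)
... | inj₁ i≤ | _ = let j′ , e′ , r = remainder i≤ y in
  i , j′ , e′ , inj₁ refl , inj₂ (remainder′ i≤ x e , r)
... | inj₂ i≥ | inj₁ j≤ = let i′ , e′ , r = remainder j≤ y in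
  i′ , j , flip-sum {j} e′ , inj₂ (remainder′ j≤ x (flip-sum {i} e) , r) , inj₁ refl
... | inj₂ i≥ | inj₂ j≥ = let j′ , e′ , r = remainder ℕₚ.≤-refl y in
  large q , j′ , e′ , inj₂ (i≥ , ℕₚ.≤-refl) , inj₂ (j≥ , r)

assoc-split : ∀ (p u₁ : List A) {a u₂ r} → p ++ (u₁ ++ a ∷ u₂) ++ r ≡ (p ++ u₁) ++ a ∷ (u₂ ++ r)
assoc-split p u₁ {a} {u₂} {r} =
  trans (cong (p ++_) (++-assoc u₁ (a ∷ u₂) r)) (sym (++-assoc p u₁ (a ∷ u₂ ++ r)))

game-pow : ∀ k q (u : List A) {m n} → Close q m n → Game k q (pow m u) (pow n u)
game-pow k zero u c = stop
game-pow k (suc q) u {m} {n} c = game k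
  (λ { {k′} refl → game-pow k′ (suc q) u (close-sym {suc q} c) })
  λ s a t e → case pow-split m u e of λ where
    (i , j , u₁ , u₂ , refl , refl , refl , refl) →
      let i′ , j′ , e′ , ci , cj = close-split q {i = i} c refl in
      pow i′ u ++ u₁ , u₂ ++ pow j′ u
      , trans (cong (λ n → pow n u) (sym e′)) (trans (pow-+ i′ (suc j′) u) (assoc-split (pow i′ u) u₁))
      , game-++ k q (game-pow k q u ci) (game-refl k q u₁)
      , game-++ k q (game-refl k q u₂) (game-pow k q u cj)

-- While Spoiler stays in the pure power, Duplicator can answer in a copy of `u` far enough from
-- `v`, so that one factor is again an instance of the lemma and the other contains no `v`.
game-insert : ∀ k q {u v : List A} {l m n} → Game k q v u →
  large q ≤ℕ l → large q ≤ℕ m → large q ≤ℕ n →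
  Game (suc k) q (pow l u) (pow m u ++ v ++ pow n u)
game-insert k zero g l≥ m≥ n≥ = stop
game-insert k (suc q) {u} {v} {l} {m} {n} g l≥ m≥ n≥ = move answer
  -- After the change of word Spoiler plays in `u^m v u^n`. The assumption replaces `v` by `u`, and
  -- the resulting power `u^(m+1+n)` is indistinguishable from `u^l`.
  (game-trans k (suc q)
    (game-++ k (suc q) (game-refl k (suc q) (pow m u)) (game-++ k (suc q) g (game-refl k (suc q) (pow n u))))
    (subst (λ x → Game k (suc q) x (pow l u)) (pow-+ m (suc n) u)
      (game-pow k (suc q) u (inj₂ (ℕₚ.≤-trans m≥ (ℕₚ.m≤m+n m (suc n)) , l≥)))))
  where
  weaken : ∀ {n} → large (suc q) ≤ℕ n → large q ≤ℕ n
  weaken p = ℕₚ.≤-trans (ℕₚ.≤-trans (ℕₚ.m≤m+n _ _) (ℕₚ.n≤1+n _)) p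
  inLeft : ∀ {i i′ j j′} u₁ a u₂ → u ≡ u₁ ++ a ∷ u₂ → i′ + suc j′ ≡ m → Close q i i′ →
    large q ≤ℕ j → large q ≤ℕ j′ →
    ∃[ s′ ] ∃[ t′ ] (pow m u ++ v ++ pow n u ≡ s′ ++ a ∷ t′
      × Game (suc k) q (pow i u ++ u₁) s′ × Game (suc k) q (u₂ ++ pow j u) t′)
  inLeft {i} {i′} {j} {j′} u₁ a u₂ refl refl ci j≥ j′≥ =
    pow i′ u ++ u₁ , u₂ ++ pow j′ u ++ v ++ pow n u
    , trans (cong (_++ v ++ pow n u) (trans (pow-+ i′ (suc j′) u) (assoc-split (pow i′ u) u₁)))
        (trans (++-assoc (pow i′ u ++ u₁) _ _)
          (cong (λ x → (pow i′ u ++ u₁) ++ a ∷ x) (++-assoc u₂ (pow j′ u) _)))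
    , game-++ (suc k) q (game-pow (suc k) q u ci) (game-refl (suc k) q u₁)
    , game-++ (suc k) q (game-refl (suc k) q u₂) (game-insert k q (game-pred k q g) j≥ j′≥ (weaken n≥))
  inRight : ∀ {i i′ j j′} u₁ a u₂ → u ≡ u₁ ++ a ∷ u₂ → i′ + suc j′ ≡ n → Close q j j′ →
    large q ≤ℕ i → large q ≤ℕ i′ →
    ∃[ s′ ] ∃[ t′ ] (pow m u ++ v ++ pow n u ≡ s′ ++ a ∷ t′
      × Game (suc k) q (pow i u ++ u₁) s′ × Game (suc k) q (u₂ ++ pow j u) t′)
  inRight {i} {i′} {j} {j′} u₁ a u₂ refl refl cj i≥ i′≥ =
    (pow m u ++ v ++ pow i′ u) ++ u₁ , u₂ ++ pow j′ u
    , trans (cong (λ x → pow m u ++ v ++ x) (pow-+ i′ (suc j′) u))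
        (trans (trans (cong (pow m u ++_) (sym (++-assoc v (pow i′ u) _))) (sym (++-assoc (pow m u) (v ++ pow i′ u) _)))
          (assoc-split (pow m u ++ v ++ pow i′ u) u₁))
    , game-++ (suc k) q (game-insert k q (game-pred k q g) i≥ (weaken m≥) i′≥) (game-refl (suc k) q u₁)
    , game-++ (suc k) q (game-refl (suc k) q u₂) (game-pow (suc k) q u cj)
  answer : Forth (Game (suc k) q) (pow l u) (pow m u ++ v ++ pow n u)
  answer s a t e with pow-split l u e
  -- The insertion must end up in a factor with long powers on both of its sides: the reply lies
  -- left of `v` when many blocks remain to the right of the cut, and right of `v` when few do.
  ... | i , j , u₁ , u₂ , p , eu , refl , refl with ℕₚ.≤-total i (large q) | ℕₚ.≤-total j (large q)
  ... | inj₁ i≤ | _ = let j′ , e′ , r = remainder i≤ m≥ in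
    inLeft u₁ a u₂ eu e′ (inj₁ refl) (remainder′ i≤ l≥ p) r
  ... | inj₂ i≥ | inj₂ j≥ = let j′ , e′ , r = remainder ℕₚ.≤-refl m≥ in
    inLeft u₁ a u₂ eu e′ (inj₂ (i≥ , ℕₚ.≤-refl)) j≥ r
  ... | inj₂ i≥ | inj₁ j≤ = let i′ , e′ , r = remainder j≤ n≥ in
    inRight u₁ a u₂ eu (flip-sum {j} e′) (inj₁ refl) (remainder′ j≤ l≥ (flip-sum {i} p)) r

-- Positions in concatenated words.

left : ∀ (u v : List A) → Pos u → Pos (u ++ v)
left (_ ∷ u) v zero    = zero
left (_ ∷ u) v (suc i) = suc (left u v i)

right : ∀ (u v : List A) → Pos v → Pos (u ++ v)
right []      v i = i
right (_ ∷ u) v i = suc (right u v i)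

lookup-left : ∀ (u v : List A) (i : Pos u) → lookup (u ++ v) (left u v i) ≡ lookup u i
lookup-left (_ ∷ u) v zero    = refl
lookup-left (_ ∷ u) v (suc i) = lookup-left u v i

lookup-right : ∀ (u v : List A) (i : Pos v) → lookup (u ++ v) (right u v i) ≡ lookup v i
lookup-right []      v i = refl
lookup-right (_ ∷ u) v i = lookup-right u v i

left-mono : ∀ (u v : List A) (i j : Pos u) → i < j → left u v i < left u v j
left-mono (_ ∷ u) v zero    (suc j) p       = s≤s z≤n
left-mono (_ ∷ u) v (suc i) (suc j) (s≤s p) = s≤s (left-mono u v i j p)

right-mono : ∀ (u v : List A) (i j : Pos v) → i < j → right u v i < right u v j
right-mono []      v i j p = p
right-mono (_ ∷ u) v i j p = s≤s (right-mono u v i j p)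

left<right : ∀ (u v : List A) (i : Pos u) (j : Pos v) → left u v i < right u v j
left<right (_ ∷ u) v zero    j = s≤s z≤n
left<right (_ ∷ u) v (suc i) j = s≤s (left<right u v i j)

side : ∀ (u v : List A) (i : Pos (u ++ v)) →
  (Σ[ j ∈ Pos u ] left u v j ≡ i) ⊎ (Σ[ j ∈ Pos v ] right u v j ≡ i)
side []      v i       = inj₂ (i , refl)
side (_ ∷ u) v zero    = inj₁ (zero , refl)
side (_ ∷ u) v (suc i) with side u v i
... | inj₁ (j , e) = inj₁ (suc j , cong suc e)
... | inj₂ (j , e) = inj₂ (j , cong suc e)

toℕ-right-zero : ∀ (u v : List A) a → toℕ (right u (a ∷ v) zero) ≡ length u
toℕ-right-zero []      v a = refl
toℕ-right-zero (_ ∷ u) v a = cong suc (toℕ-right-zero u v a)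

position-split : ∀ (u : List A) (i : Pos u) → ∃[ s ] ∃[ t ] (u ≡ s ++ lookup u i ∷ t × toℕ i ≡ length s)
position-split (a ∷ u) zero    = [] , u , refl , refl
position-split (a ∷ u) (suc i) with position-split u i
... | s , t , e , e′ = a ∷ s , t , cong (a ∷_) e , cong suc e′

-- Soundness of the game for prenex formulas.

-- A pair of words cut at the pairs of positions played so far; the R-related
-- leaves are the pairs of factors on which the game goes on independently.
data Tree {A : Set} (R : List A → List A → Set) : List A → List A → Set where
  leaf : R u v → Tree R u v
  node : Tree R s s′ → (a : A) → Tree R t t′ → Tree R (s ++ a ∷ t) (s′ ++ a ∷ t′)

private variable
  R S : List A → List A → Set

data Cut {A : Set} {R : List A → List A → Set} : {u v : List A} → Tree R u v → Set where
  here : {l : Tree R s s′} {r : Tree R t t′} → Cut (node l a r)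
  inl  : {l : Tree R s s′} {r : Tree R t t′} → Cut l → Cut (node l a r)
  inr  : {l : Tree R s s′} {r : Tree R t t′} → Cut r → Cut (node l a r)

posˡ : {T : Tree R u v} → Cut T → Pos u
posˡ (here {s = s} {t = t})        = right s (_ ∷ t) zero
posˡ (inl {s = s} {t = t} p)       = left s (_ ∷ t) (posˡ p)
posˡ (inr {s = s} {t = t} p)       = right s (_ ∷ t) (suc (posˡ p))

posʳ : {T : Tree R u v} → Cut T → Pos v
posʳ (here {s′ = s} {t′ = t})      = right s (_ ∷ t) zero
posʳ (inl {s′ = s} {t′ = t} p)     = left s (_ ∷ t) (posʳ p)
posʳ (inr {s′ = s} {t′ = t} p)     = right s (_ ∷ t) (suc (posʳ p))

data _⊏_ {A : Set} {R : List A → List A → Set} : {u v : List A} {T : Tree R u v} → Cut T → Cut T → Set where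
  l<h : {l : Tree R s s′} {r : Tree R t t′} {p : Cut l} → inl {a = a} {r = r} p ⊏ here
  h<r : {l : Tree R s s′} {r : Tree R t t′} {p : Cut r} → here ⊏ inr {a = a} {l = l} p
  l<r : {l : Tree R s s′} {r : Tree R t t′} {p : Cut l} {p′ : Cut r} → inl {a = a} p ⊏ inr p′
  l<l : {l : Tree R s s′} {r : Tree R t t′} {p p′ : Cut l} → p ⊏ p′ → inl {a = a} {r = r} p ⊏ inl p′
  r<r : {l : Tree R s s′} {r : Tree R t t′} {p p′ : Cut r} → p ⊏ p′ → inr {a = a} {l = l} p ⊏ inr p′

⊏-tri : {T : Tree R u v} (p p′ : Cut T) → p ⊏ p′ ⊎ p ≡ p′ ⊎ p′ ⊏ p
⊏-tri here    here     = inj₂ (inj₁ refl)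
⊏-tri here    (inl p′) = inj₂ (inj₂ l<h)
⊏-tri here    (inr p′) = inj₁ h<r
⊏-tri (inl p) here     = inj₁ l<h
⊏-tri (inl p) (inl p′) with ⊏-tri p p′
... | inj₁ x        = inj₁ (l<l x)
... | inj₂ (inj₁ e) = inj₂ (inj₁ (cong inl e))
... | inj₂ (inj₂ x) = inj₂ (inj₂ (l<l x))
⊏-tri (inl p) (inr p′) = inj₁ l<r
⊏-tri (inr p) here     = inj₂ (inj₂ h<r)
⊏-tri (inr p) (inl p′) = inj₂ (inj₂ l<r)
⊏-tri (inr p) (inr p′) with ⊏-tri p p′
... | inj₁ x        = inj₁ (r<r x)
... | inj₂ (inj₁ e) = inj₂ (inj₁ (cong inr e))
... | inj₂ (inj₂ x) = inj₂ (inj₂ (r<r x))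

⊏⇒<ˡ : {T : Tree R u v} {p p′ : Cut T} → p ⊏ p′ → posˡ p < posˡ p′
⊏⇒<ˡ (l<h {s = s} {t = t})   = left<right s (_ ∷ t) _ _
⊏⇒<ˡ (h<r {s = s} {t = t})   = right-mono s (_ ∷ t) zero (suc _) (s≤s z≤n)
⊏⇒<ˡ (l<r {s = s} {t = t})   = left<right s (_ ∷ t) _ _
⊏⇒<ˡ (l<l {s = s} {t = t} x) = left-mono s (_ ∷ t) _ _ (⊏⇒<ˡ x)
⊏⇒<ˡ (r<r {s = s} {t = t} x) = right-mono s (_ ∷ t) (suc _) (suc _) (s≤s (⊏⇒<ˡ x))

⊏⇒<ʳ : {T : Tree R u v} {p p′ : Cut T} → p ⊏ p′ → posʳ p < posʳ p′
⊏⇒<ʳ (l<h {s′ = s} {t′ = t})   = left<right s (_ ∷ t) _ _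
⊏⇒<ʳ (h<r {s′ = s} {t′ = t})   = right-mono s (_ ∷ t) zero (suc _) (s≤s z≤n)
⊏⇒<ʳ (l<r {s′ = s} {t′ = t})   = left<right s (_ ∷ t) _ _
⊏⇒<ʳ (l<l {s′ = s} {t′ = t} x) = left-mono s (_ ∷ t) _ _ (⊏⇒<ʳ x)
⊏⇒<ʳ (r<r {s′ = s} {t′ = t} x) = right-mono s (_ ∷ t) (suc _) (suc _) (s≤s (⊏⇒<ʳ x))

pos-< : {T : Tree R u v} (p p′ : Cut T) → posˡ p < posˡ p′ ⇔ posʳ p < posʳ p′
pos-< p p′ with ⊏-tri p p′
... | inj₁ x           = mk⇔ (λ _ → ⊏⇒<ʳ x) (λ _ → ⊏⇒<ˡ x)
... | inj₂ (inj₁ refl) = mk⇔ (λ y → contradiction y (<-irrefl refl)) (λ y → contradiction y (<-irrefl refl))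
... | inj₂ (inj₂ x)    = mk⇔ (λ y → contradiction y (<-asym (⊏⇒<ˡ x))) (λ y → contradiction y (<-asym (⊏⇒<ʳ x)))

pos-letter : {T : Tree R u v} (p : Cut T) → lookup u (posˡ p) ≡ lookup v (posʳ p)
pos-letter (here {s = s} {s′ = s′} {t = t} {t′ = t′}) =
  trans (lookup-right s (_ ∷ t) zero) (sym (lookup-right s′ (_ ∷ t′) zero))
pos-letter (inl {s = s} {s′ = s′} {t = t} {t′ = t′} p) =
  trans (lookup-left s (_ ∷ t) _) (trans (pos-letter p) (sym (lookup-left s′ (_ ∷ t′) _)))
pos-letter (inr {s = s} {s′ = s′} {t = t} {t′ = t′} p) =
  trans (lookup-right s (_ ∷ t) (suc _)) (trans (pos-letter p) (sym (lookup-right s′ (_ ∷ t′) (suc _))))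

swapTree : Tree R u v → Tree (λ x y → R y x) v u
swapTree (leaf x)     = leaf x
swapTree (node l a r) = node (swapTree l) a (swapTree r)

swapCut : {T : Tree R u v} → Cut T → Cut (swapTree T)
swapCut here    = here
swapCut (inl p) = inl (swapCut p)
swapCut (inr p) = inr (swapCut p)

posˡ-swap : {T : Tree R u v} (p : Cut T) → posˡ (swapCut p) ≡ posʳ p
posˡ-swap here                         = refl
posˡ-swap (inl {s′ = s} {t′ = t} p)    = cong (left s (_ ∷ t)) (posˡ-swap p)
posˡ-swap (inr {s′ = s} {t′ = t} p)    = cong (λ i → right s (_ ∷ t) (suc i)) (posˡ-swap p)

posʳ-swap : {T : Tree R u v} (p : Cut T) → posʳ (swapCut p) ≡ posˡ p
posʳ-swap here                         = refl
posʳ-swap (inl {s = s} {t = t} p)      = cong (left s (_ ∷ t)) (posʳ-swap p)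
posʳ-swap (inr {s = s} {t = t} p)      = cong (λ i → right s (_ ∷ t) (suc i)) (posʳ-swap p)

-- Later moves cut the leaves further. Earlier cuts must survive at the same positions, since the
-- values of variables already bound are given by them.
record Refinement {R : List A → List A → Set} (S : List A → List A → Set) {u v} (T : Tree R u v) : Set where
  field
    tree    : Tree S u v
    embed   : Cut T → Cut tree
    embedˡ  : ∀ p → posˡ (embed p) ≡ posˡ p
    embedʳ  : ∀ p → posʳ (embed p) ≡ posʳ p
open Refinement

refineLeaf : {x : R u v} → Tree S u v → Refinement S (leaf {R = R} x)
refineLeaf T = record { tree = T ; embed = λ () ; embedˡ = λ () ; embedʳ = λ () }

refineNode : {l : Tree R s s′} {r : Tree R t t′} →
  Refinement S l → ∀ a → Refinement S r → Refinement S (node l a r)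
refineNode {s = s} {s′ = s′} {t = t} {t′ = t′} l′ a r′ = record
  { tree   = node (tree l′) a (tree r′)
  ; embed  = λ { here → here ; (inl p) → inl (embed l′ p) ; (inr p) → inr (embed r′ p) }
  ; embedˡ = λ { here → refl ; (inl p) → cong (left s (a ∷ t)) (embedˡ l′ p)
               ; (inr p) → cong (λ i → right s (a ∷ t) (suc i)) (embedˡ r′ p) }
  ; embedʳ = λ { here → refl ; (inl p) → cong (left s′ (a ∷ t′)) (embedʳ l′ p)
               ; (inr p) → cong (λ i → right s′ (a ∷ t′) (suc i)) (embedʳ r′ p) } }

relax : (∀ {u v} → R u v → S u v) → (T : Tree R u v) → Refinement S T
relax f (leaf x)     = refineLeaf (leaf (f x))
relax f (node l a r) = refineNode (relax f l) a (relax f r)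

-- A position inside a leaf is answered by the game on that leaf, and one that is already a cut is
-- answered by its partner. The remaining leaves only pass from `R` to the weaker `S`, as the move
-- is spent there too.
play : (∀ {u v} → R u v → S u v) → (∀ {u v} → R u v → Forth S u v) → (T : Tree R u v) (i : Pos u) →
  Σ[ T′ ∈ Refinement S T ] Σ[ p ∈ Cut (tree T′) ] posˡ p ≡ i
play {u = u} f g (leaf x) i with lookup u i | position-split u i
... | a | s , t , refl , e with g x s a t refl
... | s′ , t′ , refl , y , z =
  refineLeaf (node (leaf y) a (leaf z)) , here , toℕ-injective (trans (toℕ-right-zero s t a) (sym e))
play f g (node {s = s} {s′ = s′} {t = t} l a r) i with side s (a ∷ t) i
... | inj₁ (j , refl) with play f g l j
... | l′ , p , refl = refineNode l′ a (relax f r) , inl p , refl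
play f g (node {s = s} {s′ = s′} l a r) i | inj₂ (zero , refl) = relax f (node l a r) , here , refl
play f g (node {s = s} {s′ = s′} l a r) i | inj₂ (suc j , refl) with play f g r j
... | r′ , p , refl = refineNode (relax f l) a r′ , inr p , refl

record Played {R : List A → List A → Set} (T : Tree R u v) (ρ : Vec (Pos u) n) (ρ′ : Vec (Pos v) n) : Set where
  constructor played
  field
    cut  : Fin n → Cut T
    cutˡ : ∀ x → posˡ (cut x) ≡ ρ at x
    cutʳ : ∀ x → posʳ (cut x) ≡ ρ′ at x

refined : {T : Tree R u v} {ρ : Vec (Pos u) n} {ρ′ : Vec (Pos v) n} →
  (T′ : Refinement S T) → Played T ρ ρ′ → Played (tree T′) ρ ρ′
refined T′ (played c l r) = played (λ x → embed T′ (c x))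
  (λ x → trans (embedˡ T′ (c x)) (l x)) (λ x → trans (embedʳ T′ (c x)) (r x))

swapped : {T : Tree R u v} {ρ : Vec (Pos u) n} {ρ′ : Vec (Pos v) n} →
  Played T ρ ρ′ → Played (swapTree T) ρ′ ρ
swapped (played c l r) = played (λ x → swapCut (c x))
  (λ x → trans (posˡ-swap (c x)) (r x)) (λ x → trans (posʳ-swap (c x)) (l x))

extended : {T : Tree R u v} {ρ : Vec (Pos u) n} {ρ′ : Vec (Pos v) n} →
  Played T ρ ρ′ → ∀ {i} (p : Cut T) → posˡ p ≡ i → Played T (i ∷ ρ) (posʳ p ∷ ρ′)
extended (played c l r) p e = played (λ { zero → p ; (suc x) → c x })
  (λ { zero → e ; (suc x) → l x }) (λ { zero → refl ; (suc x) → r x })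

qf-preserved : {φ : FO[<] A n} → QuantifierFree φ → {T : Tree R u v} →
  ∀ {ρ ρ′} → Played T ρ ρ′ → Sat u ρ φ ⇔ Sat v ρ′ φ
qf-preserved (x ≺ y) (played c l r) = subst₂ (λ i j → i ⇔ j)
  (cong₂ _<_ (l x) (l y)) (cong₂ _<_ (r x) (r y)) (pos-< (c x) (c y))
-- The constructor _≈_ of QuantifierFree is about the formula x ≺ y: equality
-- atoms are not quantifier-free in the sense of Defs.
qf-preserved (x ≈ y) P = qf-preserved (x ≺ y) P
qf-preserved {u = u} {v = v} (letter a x) (played c l r) = mk⇔ (trans (sym e)) (trans e)
  where
  e : lookup u _ ≡ lookup v _
  e = trans (cong (lookup u) (sym (l x))) (trans (pos-letter (c x)) (cong (lookup v) (r x)))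
qf-preserved true P = mk⇔ _ _
qf-preserved (not f) P = let h = qf-preserved f P in mk⇔ (λ g x → g (from h x)) (λ g x → g (to h x))
qf-preserved (f ∧ g) P = qf-preserved f P ×-⇔ qf-preserved g P
qf-preserved (f ∨ g) P = qf-preserved f P ⊎-⇔ qf-preserved g P

rank : FO[<] A n → ℕ
rank (x ≺ y)      = 0
rank (x ≈ y)      = 0
rank (letter a x) = 0
rank true         = 0
rank (not φ)      = rank φ
rank (φ ∧ ψ)      = rank φ ⊔ rank ψ
rank (φ ∨ ψ)      = rank φ ⊔ rank ψ
rank (∃′ φ)       = suc (rank φ)
rank (∀′ φ)       = suc (rank φ)

-- Quantifiers of one block are played without changing the word, and only entering the next block
-- costs a change, so `k` changes are enough for `k + 1` blocks. A universal block is transported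
-- from `v` back to `u`: a challenge in `u` is then again a move of Spoiler in the first word.
Σ-preserved : ∀ k {φ : FO[<] A n} → IsΣ (suc k) φ → rank φ ≤ℕ q → (T : Tree (Game k q) u v) →
  ∀ {ρ ρ′} → Played T ρ ρ′ → Sat u ρ φ → Sat v ρ′ φ
Π-reflected : ∀ k {φ : FO[<] A n} → IsΠ (suc k) φ → rank φ ≤ℕ q → (T : Tree (Game k q) u v) →
  ∀ {ρ ρ′} → Played T ρ ρ′ → Sat v ρ′ φ → Sat u ρ φ
Σ-preserved k (∃′ f) (s≤s r) T P (i , s) with play (game-pred k _) forth T i
... | T′ , p , e = posʳ p , Σ-preserved k f r (tree T′) (extended (refined T′ P) p e) s
Σ-preserved zero (block (qf f)) r T P s = to (qf-preserved f P) s
Σ-preserved (suc k) (block f) r T P s with relax switch (swapTree T)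
... | T′ = Π-reflected k f r (tree T′) (refined T′ (swapped P)) s
Π-reflected k (∀′ f) (s≤s r) T P s i with play (game-pred k _) forth T i
... | T′ , p , e = Π-reflected k f r (tree T′) (extended (refined T′ P) p e) (s (posʳ p))
Π-reflected zero (block (qf f)) r T P s = from (qf-preserved f P) s
Π-reflected (suc k) (block f) r T P s with relax switch (swapTree T)
... | T′ = Σ-preserved k f r (tree T′) (refined T′ (swapped P)) s

Σ-lift : {φ : FO[<] A n} → IsΣ k φ → IsΣ (suc k) φ
Π-lift : {φ : FO[<] A n} → IsΠ k φ → IsΠ (suc k) φ
Σ-lift (qf f)    = block (qf f)
Σ-lift (block f) = block (Π-lift f)
Σ-lift (∃′ f)    = ∃′ (Σ-lift f)
Π-lift (qf f)    = block (qf f)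
Π-lift (block f) = block (Σ-lift f)
Π-lift (∀′ f)    = ∀′ (Π-lift f)

Σ-mono : ∀ {m} {φ : FO[<] A n} → k ≤ℕ m → IsΣ k φ → IsΣ m φ
Σ-mono p f = go (ℕₚ.≤⇒≤′ p) f
  where
  go : ∀ {k m} {φ : FO[<] A n} → k ≤′ m → IsΣ k φ → IsΣ m φ
  go ≤′-refl     f = f
  go (≤′-step p) f = Σ-lift (go p f)

-- The game itself carries Σ-sentences of level `d + 2` from `u` to `v`, and after `switch` it
-- carries those of level `d + 1` back. Both directions together cover level `d + 1`, and
-- equivalences are closed under boolean operations.
BΣ-invariant : ∀ {φ : FO[<] A 0} {d} → IsBΣ k φ → k ≤ℕ suc d → rank φ ≤ℕ q → Game (suc d) q u v →
  Sat u [] φ ⇔ Sat v [] φ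
BΣ-invariant {d = d} (base f) p r g = mk⇔
  (Σ-preserved (suc d) (Σ-lift (Σ-mono p f)) r (leaf g) empty)
  (Σ-preserved d (Σ-mono p f) r (leaf (switch g)) empty)
  where
  empty : ∀ {u v : List A} {R : List A → List A → Set} {T : Tree R u v} → Played T [] []
  empty = played (λ ()) (λ ()) (λ ())
BΣ-invariant (not f) p r g = let h = BΣ-invariant f p r g in mk⇔ (λ g x → g (from h x)) (λ g x → g (to h x))
BΣ-invariant (_∧_ {φ} {ψ} f h) p r g =
  BΣ-invariant f p (ℕₚ.≤-trans (ℕₚ.m≤m⊔n (rank φ) (rank ψ)) r) g
  ×-⇔ BΣ-invariant h p (ℕₚ.≤-trans (ℕₚ.m≤n⊔m (rank φ) (rank ψ)) r) g
BΣ-invariant (_∨_ {φ} {ψ} f h) p r g =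
  BΣ-invariant f p (ℕₚ.≤-trans (ℕₚ.m≤m⊔n (rank φ) (rank ψ)) r) g
  ⊎-⇔ BΣ-invariant h p (ℕₚ.≤-trans (ℕₚ.m≤n⊔m (rank φ) (rank ψ)) r) g

-- Translation of FO²[<,Inv] into FO[<]

-- Each name in scope is sent to the index of its current value. Rebinding a name redirects it to
-- index zero; the index of the old value stays bound but no name points to it any more.
extend : ∀ {Γ : Subset m} (x : Fin m) → (∀ {y} → y ∈ Γ → Fin n) → ∀ {y} → y ∈ (Γ [ x ]≔ inside) → Fin (suc n)
extend {Γ = _ ∷ _} zero    σ here      = zero
extend {Γ = _ ∷ _} zero    σ (there p) = suc (σ (there p))
extend {Γ = _ ∷ _} (suc x) σ here      = suc (σ here)
extend {Γ = _ ∷ _} (suc x) σ (there p) = extend x (λ p → σ (there p)) p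

extend-value : ∀ (w : List A) {Γ : Subset m} (x : Fin m) (σ : ∀ {y} → y ∈ Γ → Fin n)
  (η : Env w Γ) {ρ : Vec (Pos w) n} → (∀ {y} (p : y ∈ Γ) → ρ at σ p ≡ value η p) →
  ∀ i {y} (p : y ∈ (Γ [ x ]≔ inside)) → (i ∷ ρ) at extend x σ p ≡ value (assign η x i) p
extend-value w zero    σ (_ ∷ _) h i here      = refl
extend-value w zero    σ (_ ∷ _) h i (there p) = h (there p)
extend-value w (suc x) σ (_ ∷ _) h i here      = h here
extend-value w (suc x) σ (_ ∷ η) h i (there p) = extend-value w x (λ p → σ (there p)) η (λ p → h (there p)) i p

toFO : ∀ {Γ} → (∀ {y} → y ∈ Γ → Fin n) → FO²[<,Inv] A Γ → FO[<] A n
toFO σ (x ≺ y)         = σ x ≺ σ y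
toFO σ (x ≈ y)         = σ x ≈ σ y
toFO σ (letter a x)    = letter a (σ x)
toFO σ (between a x y) = ∃′ (suc (σ x) ≺ zero ∧ zero ≺ suc (σ y) ∧ letter a zero)
toFO σ true            = true
toFO σ (not φ)         = not (toFO σ φ)
toFO σ (φ ∧ ψ)         = toFO σ φ ∧ toFO σ ψ
toFO σ (φ ∨ ψ)         = toFO σ φ ∨ toFO σ ψ
toFO σ (∃′ x φ)        = ∃′ (toFO (extend x σ) φ)
toFO σ (∀′ x φ)        = ∀′ (toFO (extend x σ) φ)

toFO-sat : ∀ {Γ} (φ : FO²[<,Inv] A Γ) {w : List A} (σ : ∀ {y} → y ∈ Γ → Fin n)
  {η : Env w Γ} {ρ : Vec (Pos w) n} → (∀ {y} (p : y ∈ Γ) → ρ at σ p ≡ value η p) →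
  Sat² w η φ ⇔ Sat w ρ (toFO σ φ)
toFO-sat (x ≺ y)         σ h = ≡⇒⇔ (sym (cong₂ _<_ (h x) (h y)))
toFO-sat (x ≈ y)         σ h = ≡⇒⇔ (sym (cong₂ _≡_ (h x) (h y)))
toFO-sat (letter a x) {w} σ h = ≡⇒⇔ (cong (λ i → lookup w i ≡ a) (sym (h x)))
toFO-sat (between a x y) {w} σ h =
  ≡⇒⇔ (cong₂ (λ i j → Σ[ z ∈ Pos w ] (i < z × z < j × lookup w z ≡ a)) (sym (h x)) (sym (h y)))
toFO-sat true            σ h = ≡⇒⇔ refl
toFO-sat (not φ)         σ h = let e = toFO-sat φ σ h in mk⇔ (λ g x → g (from e x)) (λ g x → g (to e x))
toFO-sat (φ ∧ ψ)         σ h = toFO-sat φ σ h ×-⇔ toFO-sat ψ σ h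
toFO-sat (φ ∨ ψ)         σ h = toFO-sat φ σ h ⊎-⇔ toFO-sat ψ σ h
toFO-sat (∃′ x φ) {w} σ {η} h = mk⇔
  (λ { (i , s) → i , to (toFO-sat φ (extend x σ) (extend-value w x σ η h i)) s })
  (λ { (i , s) → i , from (toFO-sat φ (extend x σ) (extend-value w x σ η h i)) s })
toFO-sat (∀′ x φ) {w} σ {η} h = mk⇔
  (λ s i → to (toFO-sat φ (extend x σ) (extend-value w x σ η h i)) (s i))
  (λ s i → from (toFO-sat φ (extend x σ) (extend-value w x σ η h i)) (s i))

FO²⇒FO : ∀ {L : Language A} → DefinableFO² L → DefinableFO L
FO²⇒FO (φ , f , g) = toFO σ φ , (λ x → to (toFO-sat φ σ h) (f x)) , (λ x → g (from (toFO-sat φ σ h) x))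
  where
  σ : ∀ {y} → y ∈ (outside ∷ outside ∷ []) → Fin 0
  σ (there (there ()))
  h : ∀ {w : List A} {y} (p : y ∈ (outside ∷ outside ∷ [])) → [] at σ p ≡ value {w = w} (tt ∷ tt ∷ []) p
  h (there (there ()))

-- The languages of the lower bound.

after : (w : List A) → Pos w → List A
after (a ∷ w) zero    = w
after (a ∷ w) (suc i) = after w i

⋀ : ∀ {n Γ} → (Fin n → FO²[<,Inv] A Γ) → FO²[<,Inv] A Γ
⋀ {n = zero}  f = true
⋀ {n = suc n} f = f zero ∧ ⋀ (λ c → f (suc c))

⋀-sat : ∀ {n Γ} (w : List A) {η : Env w Γ} (f : Fin n → FO²[<,Inv] A Γ) →
  Sat² w η (⋀ f) ⇔ (∀ c → Sat² w η (f c))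
⋀-sat {n = zero}  w f = mk⇔ (λ _ ()) (λ _ → tt)
⋀-sat {n = suc n} w f = let h = ⋀-sat w (λ c → f (suc c)) in mk⇔
  (λ { (x , y) zero → x ; (x , y) (suc c) → to h y c }) (λ g → g zero , from h (λ c → g (suc c)))

private
  -- Saturation makes `opening` total on ℕ; the bound `k ≤ m` is asked for only where the exact rank
  -- of a letter matters.
  clamp : ∀ m → ℕ → Fin (suc m)
  clamp zero    i       = zero
  clamp (suc m) zero    = zero
  clamp (suc m) (suc i) = suc (clamp m i)

  toℕ-clamp : ∀ {m i} → i ≤ℕ m → toℕ (clamp m i) ≡ i
  toℕ-clamp {zero}  z≤n     = refl
  toℕ-clamp {suc m} z≤n     = refl
  toℕ-clamp {suc m} (s≤s p) = cong suc (toℕ-clamp p)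

module Nested (m : ℕ) where

  Letter : Set
  Letter = Fin (suc m)

  -- The letter k opens the blocks of level k; a letter above k closes them.
  opening : ℕ → Letter
  opening = clamp m

  FO² : Set
  FO² = FO²[<,Inv] Letter (inside ∷ inside ∷ [])

  in-scope : (x : Fin 2) → x ∈ (inside ∷ inside ∷ [])
  in-scope zero       = here
  in-scope (suc zero) = there here

  other : Fin 2 → Fin 2
  other zero       = suc zero
  other (suc zero) = zero

  ∃-other : Fin 2 → FO² → FO²
  ∃-other zero       φ = ∃′ (suc zero) φ
  ∃-other (suc zero) φ = ∃′ zero φ

  open-at : ℕ → ∀ {x y} → x ∈ (inside ∷ inside ∷ []) → y ∈ (inside ∷ inside ∷ []) → Letter → FO²
  open-at k x y c with k <ℕ? toℕ c
  ... | yes _ = not (between c x y)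
  ... | no  _ = true

  opens : ℕ → Fin 2 → FO²
  opens k x = in-scope x ≺ y ∧ letter (opening k) y ∧ ⋀ (open-at k (in-scope x) y)
    where y = in-scope (other x)

  -- Two names suffice because a level looks only at what follows the current position: the position
  -- found becomes the current one and the former name is free for the next level.
  member : ℕ → Fin 2 → FO²
  member zero    x = ∃-other x (opens 0 x)
  member (suc k) x = ∃-other x (opens (suc k) x ∧ not (member k (other x)))

  Opens : ∀ k (w : List Letter) (i j : Pos w) → Set
  Opens k w i j = i < j × lookup w j ≡ opening k × (∀ z → i < z → z < j → toℕ (lookup w z) ≤ℕ k)

  opens-sat : ∀ k x {w} (η : Env w (inside ∷ inside ∷ [])) →
    Sat² w η (opens k x) ⇔ Opens k w (value η (in-scope x)) (value η (in-scope (other x)))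
  opens-sat k x {w} η = mk⇔
    (λ { (l , e , g) → l , e , λ z p q → to (clear p q) (to (⋀-sat w (open-at k _ _)) g _) })
    (λ { (l , e , g) → l , e , from (⋀-sat w (open-at k _ _)) λ c → clear′ c g })
    where
    i = value η (in-scope x) ; j = value η (in-scope (other x))
    clear : ∀ {z} → i < z → z < j → Sat² w η (open-at k (in-scope x) (in-scope (other x)) (lookup w z)) ⇔ toℕ (lookup w z) ≤ℕ k
    clear {z} p q with k <ℕ? toℕ (lookup w z)
    ... | yes r = mk⇔ (λ g → contradiction (z , p , q , refl) g) (λ s → contradiction r (ℕₚ.≤⇒≯ s))
    ... | no  r = mk⇔ (λ _ → ℕₚ.≮⇒≥ r) _
    clear′ : ∀ c → (∀ z → i < z → z < j → toℕ (lookup w z) ≤ℕ k) → Sat² w η (open-at k (in-scope x) (in-scope (other x)) c)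
    clear′ c g with k <ℕ? toℕ c
    ... | yes r = λ { (z , p , q , refl) → ℕₚ.≤⇒≯ (g z p q) r }
    ... | no  r = tt

  -- The search inside one block, as a recursion on the suffix so that it can be followed through
  -- concatenations. An opening letter may also be passed over by the second alternative, so the
  -- search can choose any of the blocks and not just the first.
  Sees : ℕ → (List Letter → Set) → List Letter → Set
  Sees k C []      = ⊥
  Sees k C (c ∷ r) = (c ≡ opening k × C r) ⊎ (toℕ c ≤ℕ k × Sees k C r)

  sees-here : ∀ k C w → Sees k C w ⇔
    (Σ[ j ∈ Pos w ] (lookup w j ≡ opening k × (∀ z → z < j → toℕ (lookup w z) ≤ℕ k) × C (after w j)))
  sees-here k C [] = mk⇔ (λ ()) (λ ())
  sees-here k C (c ∷ w) = mk⇔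
    (λ { (inj₁ (e , x)) → zero , e , (λ _ ()) , x
       ; (inj₂ (p , s)) → let j , e , g , x = to (sees-here k C w) s in
           suc j , e , (λ { zero _ → p ; (suc z) (s≤s q) → g z q }) , x })
    (λ { (zero , e , g , x) → inj₁ (e , x)
       ; (suc j , e , g , x) → inj₂ (g zero (s≤s z≤n)
           , from (sees-here k C w) (j , e , (λ z q → g (suc z) (s≤s q)) , x)) })

  sees : ∀ k C w i → Sees k C (after w i) ⇔ (Σ[ j ∈ Pos w ] (Opens k w i j × C (after w j)))
  sees k C (c ∷ w) zero = mk⇔
    (λ s → let j , e , g , x = to (sees-here k C w) s in
      suc j , (s≤s z≤n , e , λ { (suc z) _ (s≤s q) → g z q }) , x)
    (λ { (suc j , (_ , e , g) , x) → from (sees-here k C w) (j , e , (λ z q → g (suc z) (s≤s z≤n) (s≤s q)) , x) })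
  sees k C (c ∷ w) (suc i) = mk⇔
    (λ s → let j , (l , e , g) , x = to (sees k C w i) s in
      suc j , (s≤s l , e , λ { (suc z) (s≤s p) (s≤s q) → g z p q }) , x)
    (λ { (suc j , (s≤s l , e , g) , x) → from (sees k C w i)
           (j , (l , e , λ z p q → g (suc z) (s≤s p) (s≤s q)) , x) })

  Member : ℕ → List Letter → Set
  Member zero    = Sees 0 (λ _ → ⊤)
  Member (suc k) = Sees (suc k) (λ r → ¬ Member k r)

  member-sat : ∀ k x {w} (η : Env w (inside ∷ inside ∷ [])) →
    Sat² w η (member k x) ⇔ Member k (after w (value η (in-scope x)))
  member-sat zero zero {w} (i ∷ j ∷ []) = mk⇔
    (λ { (j , s) → from (sees 0 _ w i) (j , to (opens-sat 0 zero (i ∷ j ∷ [])) s , tt) })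
    (λ s → let j , o , _ = to (sees 0 _ w i) s in j , from (opens-sat 0 zero (i ∷ j ∷ [])) o)
  member-sat zero (suc zero) {w} (i ∷ j ∷ []) = mk⇔
    (λ { (i , s) → from (sees 0 _ w j) (i , to (opens-sat 0 (suc zero) (i ∷ j ∷ [])) s , tt) })
    (λ s → let i , o , _ = to (sees 0 _ w j) s in i , from (opens-sat 0 (suc zero) (i ∷ j ∷ [])) o)
  member-sat (suc k) zero {w} (i ∷ j ∷ []) = mk⇔
    (λ { (j , s , n) → from (sees (suc k) _ w i)
           (j , to (opens-sat (suc k) zero (i ∷ j ∷ [])) s , λ m → n (from (member-sat k (suc zero) (i ∷ j ∷ [])) m)) })
    (λ s → let j , o , n = to (sees (suc k) _ w i) s in
      j , from (opens-sat (suc k) zero (i ∷ j ∷ [])) o , λ m → n (to (member-sat k (suc zero) (i ∷ j ∷ [])) m))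
  member-sat (suc k) (suc zero) {w} (i ∷ j ∷ []) = mk⇔
    (λ { (i , s , n) → from (sees (suc k) _ w j)
           (i , to (opens-sat (suc k) (suc zero) (i ∷ j ∷ [])) s , λ m → n (from (member-sat k zero (i ∷ j ∷ [])) m)) })
    (λ s → let i , o , n = to (sees (suc k) _ w j) s in
      i , from (opens-sat (suc k) (suc zero) (i ∷ j ∷ [])) o , λ m → n (to (member-sat k zero (i ∷ j ∷ [])) m))

  -- In `out` every block of the new level is a member one level below, whereas `into` has one extra
  -- block that is not. They are the two words of `game-insert` with `u` the block built on `into`
  -- and `v` the block built on `out`, which yields `out-into` by induction.
  out into : ℕ → ℕ → List Letter
  out  N zero    = []
  out  N (suc k) = pow N (opening (suc k) ∷ into N k)
  into N zero    = opening 0 ∷ []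
  into N (suc k) = pow N (opening (suc k) ∷ into N k) ++ (opening (suc k) ∷ out N k)
                   ++ pow N (opening (suc k) ∷ into N k)

  out-into : ∀ k q → Game k q (out (large q) k) (into (large q) k)
  out-into zero    zero    = stop
  out-into zero    (suc q) = last λ { [] a t () ; (_ ∷ _) a t () }
  out-into (suc k) q       = game-insert k q
    (game-++ k q (game-refl k q (opening (suc k) ∷ [])) (out-into k q)) ℕₚ.≤-refl ℕₚ.≤-refl ℕₚ.≤-refl

  -- Low k r and Skipped k r state, through the effect on Sees, that r has no
  -- letter above k, respectively no letter k.
  Low : ℕ → List Letter → Set₁
  Low k r = ∀ {C} l → Sees k C l → Sees k C (r ++ l)

  low-++ : ∀ {k} r r′ → Low k r → Low k r′ → Low k (r ++ r′)
  low-++ r r′ f g l s = subst (Sees _ _) (sym (++-assoc r r′ l)) (f (r′ ++ l) (g l s))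

  low-∷ : ∀ {k c r} → toℕ c ≤ℕ k → Low k r → Low k (c ∷ r)
  low-∷ p f l s = inj₂ (p , f l s)

  low-pow : ∀ {k} N r → Low k r → Low k (pow N r)
  low-pow zero    r f l s = s
  low-pow (suc N) r f     = low-++ r (pow N r) f (low-pow N r f)

  opening-≤ : ∀ k {j} → k ≤ℕ j → toℕ (opening k) ≤ℕ j
  opening-≤ k p with ℕₚ.≤-total k m
  ... | inj₁ q = ℕₚ.≤-trans (ℕₚ.≤-reflexive (toℕ-clamp q)) p
  ... | inj₂ q = ℕₚ.≤-trans (toℕ≤pred[n] (opening k)) (ℕₚ.≤-trans q p)

  into-low : ∀ N k {j} → k ≤ℕ j → Low j (into N k)
  out-low  : ∀ N k {j} → k ≤ℕ j → Low j (out N k)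
  into-low N zero p = low-∷ (opening-≤ 0 p) (λ l s → s)
  into-low N (suc k) {j} p = low-++ (pow N _) _ U
      (low-++ (opening (suc k) ∷ out N k) _ (low-∷ (opening-≤ (suc k) p) (out-low N k (ℕₚ.<⇒≤ p))) U)
    where
    U : Low j (pow N (opening (suc k) ∷ into N k))
    U = low-pow N _ (low-∷ (opening-≤ (suc k) p) (into-low N k (ℕₚ.<⇒≤ p)))
  out-low N zero p l s = s
  out-low N (suc k) p = low-pow N _ (low-∷ (opening-≤ (suc k) p) (into-low N k (ℕₚ.<⇒≤ p)))

  -- The condition that a block of level `k` ends here, so that membership of a word is not affected
  -- by what is appended to it.
  Closed : ℕ → List Letter → Set
  Closed k []      = ⊤
  Closed k (c ∷ r) = k <ℕ toℕ c

  closed-pred : ∀ {k} r → Closed (suc k) r → Closed k r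
  closed-pred []      _ = tt
  closed-pred (c ∷ r) p = ℕₚ.<⇒≤ p

  opening-closes : ∀ {k r} → suc k ≤ℕ m → Closed k (opening (suc k) ∷ r)
  opening-closes p = ℕₚ.≤-reflexive (sym (toℕ-clamp p))

  closed-pow : ∀ {k} N u r → suc k ≤ℕ m → Closed (suc k) r → Closed k (pow N (opening (suc k) ∷ u) ++ r)
  closed-pow zero    u r p c = closed-pred r c
  closed-pow (suc N) u r p c = opening-closes {r = r} p

  not-sees : ∀ {k C} r → k ≤ℕ m → Closed k r → ¬ Sees k C r
  not-sees (c ∷ r) p q (inj₁ (refl , _)) = ℕₚ.<-irrefl (sym (toℕ-clamp p)) q
  not-sees (c ∷ r) p q (inj₂ (s , _))    = ℕₚ.≤⇒≯ s q

  Skipped : ℕ → List Letter → Set₁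
  Skipped k r = ∀ {C} l → Sees k C (r ++ l) → Sees k C l

  skipped-++ : ∀ {k} r r′ → Skipped k r → Skipped k r′ → Skipped k (r ++ r′)
  skipped-++ r r′ f g l s = g l (f (r′ ++ l) (subst (Sees _ _) (++-assoc r r′ l) s))

  skipped-∷ : ∀ {j k r} → k ≤ℕ m → j <ℕ k → Skipped k r → Skipped k (opening j ∷ r)
  skipped-∷ {j} {k} k≤ j<k f l (inj₁ (e , _)) = ⊥-elim (ℕₚ.<-irrefl
    (trans (sym (toℕ-clamp (ℕₚ.≤-trans (ℕₚ.<⇒≤ j<k) k≤))) (trans (cong toℕ e) (toℕ-clamp k≤))) j<k)
  skipped-∷ k≤ j<k f l (inj₂ (_ , s)) = f l s

  skipped-pow : ∀ {k} N r → Skipped k r → Skipped k (pow N r)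
  skipped-pow zero    r f l s = s
  skipped-pow (suc N) r f     = skipped-++ r (pow N r) f (skipped-pow N r f)

  into-skipped : ∀ N j {k} → k ≤ℕ m → j <ℕ k → Skipped k (into N j)
  out-skipped  : ∀ N j {k} → k ≤ℕ m → j <ℕ k → Skipped k (out N j)
  into-skipped N zero k≤ p = skipped-∷ k≤ p (λ l s → s)
  into-skipped N (suc j) {k} k≤ p = skipped-++ (pow N _) _ U
      (skipped-++ (opening (suc j) ∷ out N j) _ (skipped-∷ k≤ p (out-skipped N j k≤ (ℕₚ.<⇒≤ p))) U)
    where
    U : Skipped k (pow N (opening (suc j) ∷ into N j))
    U = skipped-pow N _ (skipped-∷ k≤ p (into-skipped N j k≤ (ℕₚ.<⇒≤ p)))
  out-skipped N zero k≤ p l s = s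
  out-skipped N (suc j) k≤ p = skipped-pow N _ (skipped-∷ k≤ p (into-skipped N j k≤ (ℕₚ.<⇒≤ p)))

  -- For `into`, the search passes the first power and stops at the block built on `out`. For `out`,
  -- stopping at a block contradicts that the block is a member, and passing its opening letter
  -- leads to the next block, because everything in between has letters of lower rank. The letter
  -- that opens the next block closes the level below.
  into-member : ∀ N k r → k ≤ℕ m → Closed k r → Member k (into N k ++ r)
  out-member  : ∀ N k r → k ≤ℕ m → Closed k r → ¬ Member k (out N k ++ r)
  into-member N zero r p c = inj₁ (refl , tt)
  into-member N (suc k) r p c = subst (Member (suc k)) (sym (++-assoc U (V ++ U) r))
    (low-pow N _ (low-∷ (opening-≤ (suc k) ℕₚ.≤-refl) (into-low N k (ℕₚ.n≤1+n k))) _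
      (inj₁ (refl , subst (λ x → ¬ Member k x) (sym (++-assoc (out N k) U r))
        (out-member N k (U ++ r) (ℕₚ.<⇒≤ p) (closed-pow N _ r p c)))))
    where
    U V : List Letter
    U = pow N (opening (suc k) ∷ into N k)
    V = opening (suc k) ∷ out N k
  out-member N zero r p c s = not-sees r p c s
  out-member N (suc k) r p c = blocks N
    where
    blocks : ∀ M → ¬ Member (suc k) (pow M (opening (suc k) ∷ into N k) ++ r)
    blocks zero s = not-sees r p c s
    blocks (suc M) (inj₁ (_ , n)) = n (subst (Member k) (sym (++-assoc (into N k) _ r))
      (into-member N k _ (ℕₚ.<⇒≤ p) (closed-pow M _ r p c)))
    blocks (suc M) (inj₂ (_ , s)) = blocks M
      (into-skipped N k p ℕₚ.≤-refl _ (subst (Sees (suc k) _) (++-assoc (into N k) _ r) s))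

hierarchy : (d : ℕ) → Σ[ n ∈ ℕ ] Σ[ L ∈ Language (Fin n) ] (DefinableFO² L × AlternationDepth> L d)
-- The letters 0 to `d + 1` serve the levels up to `d + 1`, and `d + 2` is the marker `top`.
hierarchy d = 3 + d , ⟦ φ ⟧² , definable , FO²⇒FO definable , lower
  where
  open Nested (2 + d)
  top = opening (2 + d)
  φ : FO²[<,Inv] Letter (outside ∷ outside ∷ [])
  -- `member` describes what follows a position, so the word gets the marker `top` in front. The
  -- second quantifier brings the other name into scope, as the type of `member` requires.
  φ = ∃′ zero (∃′ (suc zero) (letter top here ∧ member (suc d) zero))
  definable : DefinableFO² ⟦ φ ⟧²
  definable = φ , (λ x → x) , (λ x → x)
  in-L : ∀ N → ⟦ φ ⟧² (top ∷ into N (suc d))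
  in-L N = zero , zero , refl , from (member-sat (suc d) zero (zero ∷ zero ∷ []))
    (subst (Member (suc d)) (++-identityʳ _) (into-member N (suc d) [] (ℕₚ.n≤1+n _) tt))
  not-in-L : ∀ N → ¬ ⟦ φ ⟧² (top ∷ out N (suc d))
  not-in-L N (zero , j , _ , s) = out-member N (suc d) [] (ℕₚ.n≤1+n _) tt
    (subst (Member (suc d)) (sym (++-identityʳ _)) (to (member-sat (suc d) zero (zero ∷ j ∷ [])) s))
  -- A second marker inside `out` is impossible: it would be seen at level `d + 2`, whereas all
  -- letters of `out` are skipped at that level.
  not-in-L N (suc i , j , e , s) = subst (λ r → ¬ Sees (2 + d) (λ _ → ⊤) r) (++-identityʳ _)
    (λ s → out-skipped N (suc d) ℕₚ.≤-refl ℕₚ.≤-refl [] s)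
    (from (sees-here (2 + d) _ (out N (suc d))) (i , e , (λ z _ → toℕ≤pred[n] _) , tt))
  lower : ∀ k → DefinableBΣ k ⟦ φ ⟧² → d <ℕ k
  lower k (ψ , b , f , g) = ℕₚ.≰⇒> λ k≤d → not-in-L N (g (from
    (BΣ-invariant b (ℕₚ.≤-trans k≤d (ℕₚ.n≤1+n d)) ℕₚ.≤-refl
      (game-++ (suc d) (rank ψ) (game-refl (suc d) (rank ψ) (top ∷ [])) (out-into (suc d) (rank ψ))))
    (f (in-L N))))
    where N = large (rank ψ)

-- Prenex normal forms and definability in Σₖ and Πₖ

module _ {I : Set} {P Q R : I → Set} {X : Set} (e : ∀ i → X ⇔ Q i) where

  ∃-×ˡ : (∀ i → (P i × Q i) ⇔ R i) → ((Σ[ i ∈ I ] P i) × X) ⇔ (Σ[ i ∈ I ] R i)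
  ∃-×ˡ h = mk⇔ (λ { ((i , p) , x) → i , to (h i) (p , to (e i) x) })
    (λ { (i , r) → (i , proj₁ (from (h i) r)) , from (e i) (proj₂ (from (h i) r)) })

  ∃-×ʳ : (∀ i → (Q i × P i) ⇔ R i) → (X × (Σ[ i ∈ I ] P i)) ⇔ (Σ[ i ∈ I ] R i)
  ∃-×ʳ h = mk⇔ (λ { (x , (i , p)) → i , to (h i) (to (e i) x , p) })
    (λ { (i , r) → from (e i) (proj₁ (from (h i) r)) , (i , proj₂ (from (h i) r)) })

  ∀-×ˡ : I → (∀ i → (P i × Q i) ⇔ R i) → ((∀ i → P i) × X) ⇔ (∀ i → R i)
  ∀-×ˡ o h = mk⇔ (λ { (p , x) i → to (h i) (p i , to (e i) x) })
    (λ r → (λ i → proj₁ (from (h i) (r i))) , from (e o) (proj₂ (from (h o) (r o))))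

  ∀-×ʳ : I → (∀ i → (Q i × P i) ⇔ R i) → (X × (∀ i → P i)) ⇔ (∀ i → R i)
  ∀-×ʳ o h = mk⇔ (λ { (x , p) i → to (h i) (to (e i) x , p i) })
    (λ r → from (e o) (proj₁ (from (h o) (r o))) , (λ i → proj₂ (from (h i) (r i))))

lift : (Fin n → Fin m) → Fin (suc n) → Fin (suc m)
lift f zero    = zero
lift f (suc i) = suc (f i)

ren : (Fin n → Fin m) → FO[<] A n → FO[<] A m
ren f (x ≺ y)      = f x ≺ f y
ren f (x ≈ y)      = f x ≈ f y
ren f (letter a x) = letter a (f x)
ren f true         = true
ren f (not φ)      = not (ren f φ)
ren f (φ ∧ ψ)      = ren f φ ∧ ren f ψ
ren f (φ ∨ ψ)      = ren f φ ∨ ren f ψ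
ren f (∃′ φ)       = ∃′ (ren (lift f) φ)
ren f (∀′ φ)       = ∀′ (ren (lift f) φ)

ren-sat : (φ : FO[<] A n) (f : Fin n → Fin m) (w : List A) {ρ : Vec (Pos w) n} {ρ′ : Vec (Pos w) m} →
  (∀ i → ρ′ at f i ≡ ρ at i) → Sat w ρ φ ⇔ Sat w ρ′ (ren f φ)
ren-sat (x ≺ y)      f w h = ≡⇒⇔ (sym (cong₂ _<_ (h x) (h y)))
ren-sat (x ≈ y)      f w h = ≡⇒⇔ (sym (cong₂ _≡_ (h x) (h y)))
ren-sat (letter a x) f w h = ≡⇒⇔ (cong (λ i → lookup w i ≡ a) (sym (h x)))
ren-sat true         f w h = ⇔-refl
ren-sat (not φ)      f w h = ¬-⇔ (ren-sat φ f w h)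
ren-sat (φ ∧ ψ)      f w h = ren-sat φ f w h ×-⇔ ren-sat ψ f w h
ren-sat (φ ∨ ψ)      f w h = ren-sat φ f w h ⊎-⇔ ren-sat ψ f w h
ren-sat (∃′ φ)       f w h = ∃-⇔ λ i → ren-sat φ (lift f) w λ { zero → refl ; (suc j) → h j }
ren-sat (∀′ φ)       f w h = ∀-⇔ λ i → ren-sat φ (lift f) w λ { zero → refl ; (suc j) → h j }

ren-qf : {φ : FO[<] A n} (f : Fin n → Fin m) → QuantifierFree φ → QuantifierFree (ren f φ)
ren-qf f (x ≺ y)      = f x ≺ f y
ren-qf f (x ≈ y)      = f x ≺ f y
ren-qf f (letter a x) = letter a (f x)
ren-qf f true         = true
ren-qf f (not p)      = not (ren-qf f p)
ren-qf f (p ∧ q)      = ren-qf f p ∧ ren-qf f q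
ren-qf f (p ∨ q)      = ren-qf f p ∨ ren-qf f q

ren-Σ : {φ : FO[<] A n} (f : Fin n → Fin m) → IsΣ k φ → IsΣ k (ren f φ)
ren-Π : {φ : FO[<] A n} (f : Fin n → Fin m) → IsΠ k φ → IsΠ k (ren f φ)
ren-Σ f (qf p)    = qf (ren-qf f p)
ren-Σ f (block p) = block (ren-Π f p)
ren-Σ f (∃′ p)    = ∃′ (ren-Σ (lift f) p)
ren-Π f (qf p)    = qf (ren-qf f p)
ren-Π f (block p) = block (ren-Σ f p)
ren-Π f (∀′ p)    = ∀′ (ren-Π (lift f) p)

module Definability {A : Set} (_≟_ : DecidableEquality A) where

  sat? : (w : List A) (ρ : Vec (Pos w) n) (φ : FO[<] A n) → Dec (Sat w ρ φ)
  sat? w ρ (x ≺ y)      = (ρ at x) <ᶠ? (ρ at y)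
  sat? w ρ (x ≈ y)      = (ρ at x) ≟ᶠ (ρ at y)
  sat? w ρ (letter a x) = lookup w (ρ at x) ≟ a
  sat? w ρ true         = yes tt
  sat? w ρ (not φ)      = ¬? (sat? w ρ φ)
  sat? w ρ (φ ∧ ψ)      = sat? w ρ φ ×-dec sat? w ρ ψ
  sat? w ρ (φ ∨ ψ)      = sat? w ρ φ ⊎-dec sat? w ρ ψ
  sat? w ρ (∃′ φ)       = any? λ i → sat? w (i ∷ ρ) φ
  sat? w ρ (∀′ φ)       = all? λ i → sat? w (i ∷ ρ) φ

  neg-Σ : {φ : FO[<] A n} → IsΣ k φ → Σ[ ψ ∈ FO[<] A n ] (IsΠ k ψ × (∀ w ρ → (¬ Sat w ρ φ) ⇔ Sat w ρ ψ))
  neg-Π : {φ : FO[<] A n} → IsΠ k φ → Σ[ ψ ∈ FO[<] A n ] (IsΣ k ψ × (∀ w ρ → (¬ Sat w ρ φ) ⇔ Sat w ρ ψ))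
  neg-Σ {φ = φ} (qf p) = not φ , qf (not p) , λ w ρ → ⇔-refl
  neg-Σ (block p) = let ψ , q , h = neg-Π p in ψ , block q , h
  neg-Σ (∃′ p) = let ψ , q , h = neg-Σ p in ∀′ ψ , ∀′ q , λ w ρ → mk⇔
    (λ s i → to (h w (i ∷ ρ)) λ x → s (i , x)) (λ { s (i , x) → from (h w (i ∷ ρ)) (s i) x })
  neg-Π {φ = φ} (qf p) = not φ , qf (not p) , λ w ρ → ⇔-refl
  neg-Π (block p) = let ψ , q , h = neg-Σ p in ψ , block q , h
  neg-Π (∀′ {φ = φ} p) = let ψ , q , h = neg-Π p in ∃′ ψ , ∃′ q , λ w ρ → mk⇔
    (λ s → let i , x = ¬∀⟶∃¬ _ _ (λ i → sat? w (i ∷ ρ) φ) s in i , to (h w (i ∷ ρ)) x)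
    (λ { (i , x) s → from (h w (i ∷ ρ)) x (s i) })

  -- Prenexing moves quantifiers out of a conjunction, which needs a nonempty domain.
  Conjunction : (FO[<] A n → Set) → FO[<] A n → FO[<] A n → Set
  Conjunction {n} Is φ ψ = Σ[ χ ∈ FO[<] A n ] (Is χ ×
    (∀ w → Pos w → ∀ ρ → (Sat w ρ φ × Sat w ρ ψ) ⇔ Sat w ρ χ))

  -- The leading quantifiers of `φ` are pulled out first, then those of `ψ` by `conj-Σ′`, and only
  -- then do both formulas descend to the next block. So the two leading blocks merge into one and
  -- the level does not grow.
  conj-Σ  : ∀ k {φ ψ : FO[<] A n} → IsΣ k φ → IsΣ k ψ → Conjunction (IsΣ k) φ ψ
  conj-Σ′ : ∀ k {φ ψ : FO[<] A n} → IsΠ k φ → IsΣ (suc k) ψ → Conjunction (IsΣ (suc k)) φ ψ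
  conj-Π  : ∀ k {φ ψ : FO[<] A n} → IsΠ k φ → IsΠ k ψ → Conjunction (IsΠ k) φ ψ
  conj-Π′ : ∀ k {φ ψ : FO[<] A n} → IsΣ k φ → IsΠ (suc k) ψ → Conjunction (IsΠ (suc k)) φ ψ
  conj-Σ zero (qf p) (qf q) = _ , qf (p ∧ q) , λ w _ ρ → ⇔-refl
  conj-Σ (suc k) (block p) q = conj-Σ′ k p q
  conj-Σ (suc k) {ψ = ψ} (∃′ p) q =
    let χ , r , h = conj-Σ (suc k) p (ren-Σ suc q) in
    ∃′ χ , ∃′ r , λ w o ρ → ∃-×ˡ (λ i → ren-sat ψ suc w λ _ → refl) (λ i → h w o (i ∷ ρ))
  conj-Σ′ k p (block q) = let χ , r , h = conj-Π k p q in χ , block r , h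
  conj-Σ′ k {φ} p (∃′ q) =
    let χ , r , h = conj-Σ′ k (ren-Π suc p) q in
    ∃′ χ , ∃′ r , λ w o ρ → ∃-×ʳ (λ i → ren-sat φ suc w λ _ → refl) (λ i → h w o (i ∷ ρ))
  conj-Π zero (qf p) (qf q) = _ , qf (p ∧ q) , λ w _ ρ → ⇔-refl
  conj-Π (suc k) (block p) q = conj-Π′ k p q
  conj-Π (suc k) {ψ = ψ} (∀′ p) q =
    let χ , r , h = conj-Π (suc k) p (ren-Π suc q) in
    ∀′ χ , ∀′ r , λ w o ρ → ∀-×ˡ (λ i → ren-sat ψ suc w λ _ → refl) o (λ i → h w o (i ∷ ρ))
  conj-Π′ k p (block q) = let χ , r , h = conj-Σ k p q in χ , block r , h
  conj-Π′ k {φ} p (∀′ q) =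
    let χ , r , h = conj-Π′ k (ren-Σ suc p) q in
    ∀′ χ , ∀′ r , λ w o ρ → ∀-×ʳ (λ i → ren-sat φ suc w λ _ → refl) o (λ i → h w o (i ∷ ρ))

  data Polarity : Set where
    σ π : Polarity

  dual : Polarity → Polarity
  dual σ = π
  dual π = σ

  Is : Polarity → ℕ → FO[<] A n → Set
  Is σ k φ = IsΣ k φ
  Is π k φ = IsΠ k φ

  Predicate : ℕ → Set₁
  Predicate n = (w : List A) → Vec (Pos w) n → Set

  -- Definability is required on nonempty words alone, where prenexing is sound; the empty word is
  -- repaired in the final sentence.
  record Def (pol : Polarity) (k : ℕ) (P : Predicate n) : Set where
    constructor def
    field
      formula : FO[<] A n
      is      : Is pol k formula
      defines : ∀ w → Pos w → ∀ ρ → P w ρ ⇔ Sat w ρ formula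
  open Def public

  private variable
    pol : Polarity
    P Q : Predicate n

  def? : Def pol k P → ∀ w → Pos w → ∀ ρ → Dec (P w ρ)
  def? (def φ _ h) w o ρ = map′ (from (h w o ρ)) (to (h w o ρ)) (sat? w ρ φ)

  cast : (∀ w → Pos w → ∀ ρ → P w ρ ⇔ Q w ρ) → Def pol k P → Def pol k Q
  cast e (def φ p h) = def φ p λ w o ρ → h w o ρ ⇔-∘ ⇔-sym (e w o ρ)

  is-lift : ∀ pol {φ : FO[<] A n} → Is pol k φ → Is pol (suc k) φ
  is-lift σ = Σ-lift
  is-lift π = Π-lift

  lifted : Def pol k P → Def pol (suc k) P
  lifted {pol = pol} (def φ p h) = def φ (is-lift pol p) h

  blocked : ∀ pol → Def (dual pol) k P → Def pol (suc k) P
  blocked σ (def φ p h) = def φ (block p) h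
  blocked π (def φ p h) = def φ (block p) h

  raised : ∀ pol pol′ → Def pol k P → Def pol′ (suc k) P
  raised σ σ d = lifted d
  raised σ π d = blocked π d
  raised π σ d = blocked σ d
  raised π π d = lifted d

  qf-def : ∀ pol k {φ : FO[<] A n} → QuantifierFree φ → Def pol k (λ w ρ → Sat w ρ φ)
  qf-def σ zero    p = def _ (qf p) λ w o ρ → ⇔-refl
  qf-def π zero    p = def _ (qf p) λ w o ρ → ⇔-refl
  qf-def pol (suc k) p = lifted (qf-def pol k p)

  infixr 7 _∧ᵈ_
  infixr 6 _∨ᵈ_
  infixr 5 _→ᵈ_

  _∧ᵈ_ : Def pol k P → Def pol k Q → Def pol k (λ w ρ → P w ρ × Q w ρ)
  _∧ᵈ_ {pol = σ} {k} (def φ p h) (def ψ q i) = let χ , r , j = conj-Σ k p q in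
    def χ r λ w o ρ → j w o ρ ⇔-∘ (h w o ρ ×-⇔ i w o ρ)
  _∧ᵈ_ {pol = π} {k} (def φ p h) (def ψ q i) = let χ , r , j = conj-Π k p q in
    def χ r λ w o ρ → j w o ρ ⇔-∘ (h w o ρ ×-⇔ i w o ρ)

  ¬ᵈ_ : Def (dual pol) k P → Def pol k (λ w ρ → ¬ P w ρ)
  ¬ᵈ_ {pol = σ} (def φ p h) = let ψ , q , i = neg-Π p in def ψ q λ w o ρ → i w ρ ⇔-∘ ¬-⇔ (h w o ρ)
  ¬ᵈ_ {pol = π} (def φ p h) = let ψ , q , i = neg-Σ p in def ψ q λ w o ρ → i w ρ ⇔-∘ ¬-⇔ (h w o ρ)

  dual-def : ∀ pol → Def pol k P → Def (dual (dual pol)) k P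
  dual-def σ d = d
  dual-def π d = d

  -- De Morgan's law reduces disjunction to conjunction, so quantifiers are pulled out of
  -- conjunctions only. It is constructively valid here because satisfaction in a finite word is
  -- decidable.
  _∨ᵈ_ : Def pol k P → Def pol k Q → Def pol k (λ w ρ → P w ρ ⊎ Q w ρ)
  _∨ᵈ_ {pol} p q = cast
    (λ w o ρ → mk⇔
      (λ x → case (def? p w o ρ) (def? q w o ρ) x)
      (λ { (inj₁ y) (x , _) → x y ; (inj₂ y) (_ , x) → x y }))
    (¬ᵈ ((¬ᵈ dual-def pol p) ∧ᵈ (¬ᵈ dual-def pol q)))
    where
    case : {X Y : Set} → Dec X → Dec Y → ¬ (¬ X × ¬ Y) → X ⊎ Y
    case (yes x) _       _ = inj₁ x
    case (no _)  (yes y) _ = inj₂ y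
    case (no x)  (no y)  f = ⊥-elim (f (x , y))

  _→ᵈ_ : Def (dual pol) k P → Def pol k Q → Def pol k (λ w ρ → P w ρ → Q w ρ)
  p →ᵈ q = cast
    (λ w o ρ → mk⇔ (λ { (inj₁ x) y → contradiction y x ; (inj₂ z) _ → z }) (case (def? p w o ρ)))
    ((¬ᵈ p) ∨ᵈ q)
    where
    case : {X Y : Set} → Dec X → (X → Y) → ¬ X ⊎ Y
    case (yes x) f = inj₂ (f x)
    case (no x)  f = inj₁ x

  ∃ᵈ : Def σ (suc k) P → Def σ (suc k) (λ w ρ → Σ[ i ∈ Pos w ] P w (i ∷ ρ))
  ∃ᵈ (def φ p h) = def (∃′ φ) (∃′ p) λ w o ρ → ∃-⇔ λ i → h w o (i ∷ ρ)

  ∀ᵈ : Def π (suc k) P → Def π (suc k) (λ w ρ → (i : Pos w) → P w (i ∷ ρ))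
  ∀ᵈ (def φ p h) = def (∀′ φ) (∀′ p) λ w o ρ → ∀-⇔ λ i → h w o (i ∷ ρ)

  ren-is : ∀ pol (f : Fin n → Fin m) {φ : FO[<] A n} → Is pol k φ → Is pol k (ren f φ)
  ren-is σ f = ren-Σ f
  ren-is π f = ren-Π f

  renᵈ : {P : Predicate n} (f : Fin n → Fin m) (g : ∀ w → Vec (Pos w) m → Vec (Pos w) n) →
    (∀ w ρ i → ρ at f i ≡ g w ρ at i) → Def pol k P → Def pol k (λ w ρ → P w (g w ρ))
  renᵈ {pol = pol} f g e (def φ p h) = def (ren f φ) (ren-is pol f p)
    λ w o ρ → ren-sat φ f w (e w ρ) ⇔-∘ h w o (g w ρ)

  every : ∀ m {Q : Fin m → Predicate n} → (∀ i → Def pol k (Q i)) → Def pol k (λ w ρ → ∀ i → Q i w ρ)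
  every {pol = pol} {k} zero    d = cast (λ w o ρ → mk⇔ (λ _ ()) (λ _ → tt)) (qf-def pol k true)
  every (suc m) d = cast
    (λ w o ρ → mk⇔ (λ { (x , y) zero → x ; (x , y) (suc i) → y i }) (λ f → f zero , λ i → f (suc i)))
    (d zero ∧ᵈ every m λ i → d (suc i))

-- The order of positions, read in either direction.

data Direction : Set where
  fwd bwd : Direction

op : Direction → Direction
op fwd = bwd
op bwd = fwd

private variable
  x y z e : Fin n

lt : Direction → Fin n → Fin n → Set
lt fwd x y = x < y
lt bwd x y = y < x

le : Direction → Fin n → Fin n → Set
le d x y = ¬ lt d y x

lt-trans : ∀ d → lt d x y → lt d y z → lt d x z
lt-trans {x = x} fwd p q = <-trans {i = x} p q
lt-trans {z = z} bwd p q = <-trans {i = z} q p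

lt-irrefl : ∀ d → ¬ lt d x x
lt-irrefl fwd = <-irrefl refl
lt-irrefl bwd = <-irrefl refl

lt-cmp : ∀ d (x y : Fin n) → lt d x y ⊎ x ≡ y ⊎ lt d y x
lt-cmp fwd x y with <-cmp x y
... | tri< p _ _ = inj₁ p
... | tri≈ _ p _ = inj₂ (inj₁ p)
... | tri> _ _ p = inj₂ (inj₂ p)
lt-cmp bwd x y with <-cmp x y
... | tri< p _ _ = inj₂ (inj₂ p)
... | tri≈ _ p _ = inj₂ (inj₁ p)
... | tri> _ _ p = inj₁ p

lt? : ∀ d (x y : Fin n) → Dec (lt d x y)
lt? fwd x y = x <ᶠ? y
lt? bwd x y = y <ᶠ? x

lt-op : ∀ d → lt d x y → lt (op d) y x
lt-op fwd p = p
lt-op bwd p = p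

lt-op⁻ : ∀ d → lt (op d) x y → lt d y x
lt-op⁻ fwd p = p
lt-op⁻ bwd p = p

lt-wf : ∀ d → WellFounded (lt {n} d)
lt-wf fwd = <-wellFounded
lt-wf bwd = >-wellFounded

le-refl : ∀ d → le d x x
le-refl d = lt-irrefl d

lt⇒le : ∀ d → lt d x y → le d x y
lt⇒le d p q = lt-irrefl d (lt-trans d p q)

le-split : ∀ d → le d x y → x ≡ y ⊎ lt d x y
le-split {x = x} {y = y} d p with lt-cmp d x y
... | inj₁ q        = inj₂ q
... | inj₂ (inj₁ e) = inj₁ e
... | inj₂ (inj₂ q) = contradiction q p

le-lt-trans : ∀ d → le d x y → lt d y z → lt d x z
le-lt-trans d p q with le-split d p
... | inj₁ refl = q
... | inj₂ r    = lt-trans d r q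

lt-le-trans : ∀ d → lt d x y → le d y z → lt d x z
lt-le-trans d p q with le-split d q
... | inj₁ refl = p
... | inj₂ r    = lt-trans d p r

le-trans : ∀ d → le d x y → le d y z → le d x z
le-trans d p q r = q (lt-le-trans d r p)

Edge : Direction → Fin n → Set
Edge d x = ∀ z → ¬ lt d x z

Succ : Direction → Fin n → Fin n → Set
Succ d x y = lt d x y × (∀ z → ¬ (lt d x z × lt d z y))

neighbour : ∀ d (x : Fin n) → Edge d x ⊎ (Σ[ y ∈ Fin n ] Succ d x y)
neighbour {n} d x with any? (lt? d x)
... | no none     = inj₁ λ z p → none (z , p)
... | yes (z , p) = inj₂ (closest z p (lt-wf d z))
  where
  closest : ∀ z → lt d x z → Acc (lt d) z → Σ[ y ∈ Fin n ] Succ d x y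
  closest z p (acc rs) with any? (λ y → lt? d x y ×-dec lt? d y z)
  ... | no none         = z , p , λ y q → none (y , q)
  ... | yes (y , q , r) = closest y q (rs r)

succ-op : ∀ d → Succ d x y → Succ (op d) y x
succ-op fwd (p , f) = p , λ { z (q , r) → f z (r , q) }
succ-op bwd (p , f) = p , λ { z (q , r) → f z (r , q) }

succ-op⁻ : ∀ d → Succ (op d) x y → Succ d y x
succ-op⁻ fwd (p , f) = p , λ { z (q , r) → f z (r , q) }
succ-op⁻ bwd (p , f) = p , λ { z (q , r) → f z (r , q) }

succ-unique : ∀ d → Succ d x y → Succ d x z → y ≡ z
succ-unique {y = y} {z = z} d (p , f) (q , g) with lt-cmp d y z
... | inj₁ r        = ⊥-elim (g y (p , r))
... | inj₂ (inj₁ e) = e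
... | inj₂ (inj₂ r) = ⊥-elim (f z (q , r))

succ-least : ∀ d → Succ d x y → lt d x z → le d y z
succ-least d (p , f) q r = f _ (q , r)

succ-greatest : ∀ d → Succ d x y → lt d z y → le d z x
succ-greatest d (p , f) q r = f _ (r , q)

-- A bound and not an exact distance: `here` is available for every `k`.
data Reach (d : Direction) {n} : ℕ → Fin n → Fin n → Set where
  here : Reach d k x x
  step : Succ d x y → Reach d k y z → Reach d (suc k) x z

reach-le : ∀ d → Reach d k x y → le d x y
reach-le d here       = le-refl d
reach-le d (step s r) = lt⇒le d (lt-le-trans d (proj₁ s) (reach-le d r))

reach-snoc : ∀ d → Reach d k x y → Succ d y z → Reach d (suc k) x z
reach-snoc d here       t = step t here
reach-snoc d (step s r) t = step s (reach-snoc d r t)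

reach-op : ∀ d → Reach d k x y → Reach (op d) k y x
reach-op d here       = here
reach-op d (step s r) = reach-snoc (op d) (reach-op d r) (succ-op d s)

reach-op⁻ : ∀ d → Reach (op d) k x y → Reach d k y x
reach-op⁻ fwd = reach-op bwd
reach-op⁻ bwd = reach-op fwd

reach-last : ∀ d → Reach d k x y → x ≡ y ⊎ (∃[ l ] ∃[ z ] (k ≡ suc l × Reach d l x z × Succ d z y))
reach-last d here = inj₁ refl
reach-last d (step s r) with reach-last d r
... | inj₁ refl                   = inj₂ (_ , _ , refl , here , s)
... | inj₂ (l , z , refl , r′ , t) = inj₂ (_ , z , refl , step s r′ , t)

reach-between : ∀ d → Reach d k x z → le d x y → le d y z → Reach d k x y
reach-between d r p q with le-split d p
... | inj₁ refl = here
reach-between d here       p q | inj₂ l = contradiction l q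
reach-between d (step s r) p q | inj₂ l = step s (reach-between d r (succ-least d s l) q)

le⇒reach : ∀ d → le d x y → ∃[ k ] Reach d k x y
le⇒reach {x = x} {y = y} d p = go y p (lt-wf d y)
  where
  go : ∀ y → le d x y → Acc (lt d) y → ∃[ k ] Reach d k x y
  go y p (acc rs) with le-split d p
  ... | inj₁ refl = 0 , here
  ... | inj₂ l with neighbour (op d) y
  ... | inj₁ edge    = contradiction (lt-op d l) (edge x)
  ... | inj₂ (z , s) =
    let t = succ-op⁻ d s ; k , r = go z (succ-greatest d t l) (rs (proj₁ t)) in suc k , reach-snoc d r t

-- Local properties and their Σ₂ definitions.

module Local {A : Set} (_≟_ : DecidableEquality A) where
  open Definability _≟_

  -- Words are explicit: a position does not determine its word.
  Within : Direction → A → (w : List A) → Pos w → Pos w → Set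
  Within d c w x y = le d x y × (∀ z → le d x z × lt d z y → lookup w z ≡ c)

  lt-def : ∀ d (x y : Fin n) s k → Def s k (λ w ρ → lt d (ρ at x) (ρ at y))
  lt-def fwd x y s k = qf-def s k (x ≺ y)
  lt-def bwd x y s k = qf-def s k (y ≺ x)

  letter-def : ∀ c (x : Fin n) s k → Def s k (λ w ρ → lookup w (ρ at x) ≡ c)
  letter-def c x s k = qf-def s k (letter c x)

  -- This relation and the next two are Π₁, hence at level 2 they are available in both polarities
  -- and may be used freely there.
  edge-def : ∀ d (x : Fin n) s → Def s 2 (λ w ρ → Edge d (ρ at x))
  edge-def d x s = raised π s (∀ᵈ (¬ᵈ lt-def d (suc x) zero σ 1))

  succ-def : ∀ d (x y : Fin n) s → Def s 2 (λ w ρ → Succ d (ρ at x) (ρ at y))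
  succ-def d x y s = raised π s (lt-def d x y π 1 ∧ᵈ ∀ᵈ (¬ᵈ (lt-def d (suc x) zero σ 1 ∧ᵈ lt-def d zero (suc y) σ 1)))

  within-def : ∀ d c (x y : Fin n) s → Def s 2 (λ w ρ → Within d c w (ρ at x) (ρ at y))
  within-def d c x y s = raised π s
    ((¬ᵈ lt-def d y x σ 1) ∧ᵈ ∀ᵈ (((¬ᵈ lt-def d zero (suc x) π 1) ∧ᵈ lt-def d zero (suc y) σ 1) →ᵈ letter-def c zero π 1))

  -- Neighbours are unique, so a universal quantifier over positions at bounded distance can be
  -- replaced by naming them one after the other existentially, until the bound or an edge of the
  -- word is met. This keeps the formula in Σ₂.
  reach-def : ∀ {n} {Q : Predicate (suc n)} → Def σ 2 Q → ∀ d k (x : Fin n) →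
    Def σ 2 (λ w ρ → ∀ y → Reach d k (ρ at x) y → Q w (y ∷ ρ))
  reach-def {n} {Q} q d k x = body k
    where
    now : Def σ 2 (λ w ρ → Q w (ρ at x ∷ ρ))
    now = renᵈ (λ { zero → x ; (suc i) → i }) (λ w ρ → ρ at x ∷ ρ) (λ { w ρ zero → refl ; w ρ (suc i) → refl }) q
    body : ∀ k → Def σ 2 (λ w ρ → ∀ y → Reach d k (ρ at x) y → Q w (y ∷ ρ))
    body zero = cast (λ w o ρ → mk⇔ (λ { h _ here → h }) (λ f → f _ here)) now
    body (suc k) = cast
      (λ w o ρ → mk⇔
        (λ { (h , _) y here → h
           ; (_ , inj₁ edge) y (step s r) → contradiction (proj₁ s) (edge _)
           ; (_ , inj₂ (z , t , f)) y (step s r) → f y (subst (λ z → Reach d k z y) (succ-unique d s t) r) })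
        (λ f → f _ here , rest w ρ f (neighbour d (ρ at x))))
      (now ∧ᵈ (edge-def d x σ ∨ᵈ ∃ᵈ (succ-def d (suc x) zero σ ∧ᵈ
        reach-def (renᵈ {P = Q} (λ { zero → zero ; (suc i) → suc (suc i) }) (λ { w (y ∷ z ∷ ρ) → y ∷ ρ })
          (λ { w (y ∷ z ∷ ρ) zero → refl ; w (y ∷ z ∷ ρ) (suc i) → refl }) q) d k zero)))
      where
      rest : ∀ w ρ → (∀ y → Reach d (suc k) (ρ at x) y → Q w (y ∷ ρ)) →
        Edge d (ρ at x) ⊎ (Σ[ z ∈ Pos w ] Succ d (ρ at x) z) →
        Edge d (ρ at x) ⊎ (Σ[ z ∈ Pos w ] (Succ d (ρ at x) z × (∀ y → Reach d k z y → Q w (y ∷ ρ))))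
      rest w ρ f (inj₁ edge)    = inj₁ edge
      rest w ρ f (inj₂ (z , s)) = inj₂ (z , s , λ y r → f y (step s r))

  Good : ∀ w → Vec (Pos w) n → A → Pos w → Set
  Good w ρ c y = lookup w y ≡ c × (∀ i → y ≢ ρ at i)

  good? : ∀ w (ρ : Vec (Pos w) n) c y → Dec (Good w ρ c y)
  good? w ρ c y = (lookup w y ≟ c) ×-dec all? (λ i → ¬? (y ≟ᶠ (ρ at i)))

  Clear : ∀ w → Vec (Pos w) n → A → Direction → ℕ → Pos w → Set
  Clear w ρ c d zero    y = Good w ρ c y
  Clear w ρ c d (suc k) y = Good w ρ c y × (Σ[ z ∈ Pos w ] (Succ d y z × Clear w ρ c d k z))

  Window : ∀ w → Vec (Pos w) n → A → ℕ → Pos w → Set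
  Window w ρ c k y = ∀ d → Clear w ρ c d k y

  clear-good : ∀ w (ρ : Vec (Pos w) n) c d k {y} → Clear w ρ c d k y → Good w ρ c y
  clear-good w ρ c d zero    g       = g
  clear-good w ρ c d (suc k) (g , _) = g

  clear-mono : ∀ w (ρ : Vec (Pos w) n) c d {k l y} → k ≤ℕ l → Clear w ρ c d l y → Clear w ρ c d k y
  clear-mono w ρ c d {l = l} z≤n h = clear-good w ρ c d l h
  clear-mono w ρ c d (s≤s p) (g , z , s , h) = g , z , s , clear-mono w ρ c d p h

  window-mono : ∀ w (ρ : Vec (Pos w) n) c {k l y} → k ≤ℕ l → Window w ρ c l y → Window w ρ c k y
  window-mono w ρ c p h d = clear-mono w ρ c d p (h d)

  window-good : ∀ w (ρ : Vec (Pos w) n) c k {y} → Window w ρ c k y → Good w ρ c y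
  window-good w ρ c k h = clear-good w ρ c fwd k (h fwd)

  window-step : ∀ w (ρ : Vec (Pos w) n) c d k {y z} → Window w ρ c (suc k) y → Succ d y z → Window w ρ c k z
  window-step w ρ c d k {y} {z} h s = λ d′ → both d d′ s (ahead (h d)) (h d′)
    where
    ahead : Clear w ρ c d (suc k) y → Clear w ρ c d k z
    ahead (_ , z′ , t , g) = subst (Clear w ρ c d k) (succ-unique d t s) g
    behind : ∀ d k → Succ (op d) y z → Good w ρ c z → Clear w ρ c d (suc k) y → Clear w ρ c d k z
    behind d zero    s g h = g
    behind d (suc k) s g h = g , y , succ-op⁻ d s , clear-mono w ρ c d (ℕₚ.m≤n+m k 2) h
    both : ∀ d d′ → Succ d y z → Clear w ρ c d k z → Clear w ρ c d′ (suc k) y → Clear w ρ c d′ k z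
    both fwd fwd s g h = g
    both fwd bwd s g h = behind bwd k s (clear-good w ρ c fwd k g) h
    both bwd fwd s g h = behind fwd k s (clear-good w ρ c bwd k g) h
    both bwd bwd s g h = g

  Obstacle : ∀ w → Vec (Pos w) n → A → Direction → ℕ → Pos w → Set
  Obstacle w ρ c d k y = Σ[ z ∈ Pos w ] (Reach d k y z × (¬ Good w ρ c z ⊎ Edge d z))

  clear? : ∀ w (ρ : Vec (Pos w) n) c d k y → Clear w ρ c d k y ⊎ Obstacle w ρ c d k y
  clear? w ρ c d k y with good? w ρ c y
  ... | no bad = inj₂ (y , here , inj₁ bad)
  clear? w ρ c d zero    y | yes g = inj₁ g
  clear? w ρ c d (suc k) y | yes g with neighbour d y
  ... | inj₁ edge = inj₂ (y , here , inj₂ edge)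
  ... | inj₂ (z , s) with clear? w ρ c d k z
  ... | inj₁ h           = inj₁ (g , z , s , h)
  ... | inj₂ (t , r , b) = inj₂ (t , step s r , b)

  not-good : ∀ w (ρ : Vec (Pos w) n) c y → ¬ Good w ρ c y → lookup w y ≢ c ⊎ (∃[ i ] y ≡ ρ at i)
  not-good w ρ c y bad with any? (λ i → y ≟ᶠ (ρ at i))
  ... | yes h = inj₂ h
  ... | no h  = inj₁ λ e → bad (e , λ i q → h (i , q))

  Unary : ℕ → Set₁
  Unary n = (w : List A) → Vec (Pos w) n → Pos w → Set

  At-head : Unary n → Predicate (suc n)
  At-head P w ρ = P w (tail ρ) (ρ at zero)

  -- A property of positions, relative to the parameters ρ, which inside a
  -- constant factor without parameters does not depend on the position,
  -- except near the ends of the factor.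
  record IsLocal (P : Unary n) : Set where
    constructor local
    field
      yes-def : Def σ 2 (At-head P)
      no-def  : Def σ 2 (λ w ρ → ¬ At-head P w ρ)
      radius  : ℕ
      uniform : ∀ w ρ c d {y z} → Succ d y z → Window w ρ c radius y → Window w ρ c radius z → P w ρ y → P w ρ z
  open IsLocal public

  private variable
    P Q : Unary n

  local? : IsLocal P → ∀ w ρ x → Dec (P w ρ x)
  local? p w ρ x = def? (yes-def p) w x (x ∷ ρ)

  yes-defᵖ : IsLocal P → Def π 2 (At-head P)
  yes-defᵖ p = cast (λ w o ρ → mk⇔ (decidable-stable (def? (yes-def p) w o ρ)) (λ h n → n h)) (¬ᵈ no-def p)

  local-letter : ∀ a → IsLocal {n} (λ w ρ x → lookup w x ≡ a)
  local-letter a = local (letter-def a zero σ 2) (¬ᵈ letter-def a zero π 2) 0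
    λ w ρ c d s h h′ e → trans (proj₁ (h′ fwd)) (trans (sym (proj₁ (h fwd))) e)

  local-true : IsLocal {n} (λ w ρ x → ⊤)
  local-true = local (qf-def σ 2 true) (¬ᵈ qf-def π 2 true) 0 λ w ρ c d s h h′ e → tt

  local-cut : ∀ d (i : Fin n) → IsLocal (λ w ρ x → lt d x (ρ at i))
  local-cut d i = local
    (cast (λ { w o (x ∷ ρ) → ⇔-refl }) (lt-def d zero (suc i) σ 2))
    (cast (λ { w o (x ∷ ρ) → ⇔-refl }) (¬ᵈ lt-def d zero (suc i) π 2)) 0
    λ w ρ c d′ s h h′ p → cut d d′ s p λ e → proj₂ (h′ fwd) i e
    where
    cut : ∀ {n} d d′ {x y z : Fin n} → Succ d′ x y → lt d x z → y ≢ z → lt d y z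
    cut d d′ {x} {y} {z} s p n with lt-cmp d y z
    ... | inj₁ q        = q
    ... | inj₂ (inj₁ e) = contradiction e n
    cut fwd fwd s p n | inj₂ (inj₂ q) = ⊥-elim (proj₂ s _ (p , q))
    cut bwd bwd s p n | inj₂ (inj₂ q) = ⊥-elim (proj₂ s _ (p , q))
    cut fwd bwd s p n | inj₂ (inj₂ q) = ⊥-elim (<-asym (proj₁ s) (<-trans p q))
    cut bwd fwd s p n | inj₂ (inj₂ q) = ⊥-elim (<-asym (proj₁ s) (<-trans q p))

  local-not : IsLocal P → IsLocal (λ w ρ x → ¬ P w ρ x)
  local-not p = local (no-def p)
    (cast (λ w o ρ → mk⇔ (λ h n → n h) (decidable-stable (def? (yes-def p) w o ρ))) (yes-def p)) (radius p)
    λ w ρ c d s h h′ n x → n (uniform p w ρ c (op d) (succ-op d s) h′ h x)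

  local-and : IsLocal P → IsLocal Q → IsLocal (λ w ρ x → P w ρ x × Q w ρ x)
  local-and p q = local (yes-def p ∧ᵈ yes-def q)
    (cast (λ w o ρ → mk⇔ (λ { (inj₁ n) (x , _) → n x ; (inj₂ n) (_ , y) → n y })
      (deMorgan (def? (yes-def p) w o ρ))) (no-def p ∨ᵈ no-def q))
    (radius p ⊔ radius q)
    λ w ρ c d s h h′ (x , y) →
      uniform p w ρ c d s (windowˡ w ρ c h) (windowˡ w ρ c h′) x , uniform q w ρ c d s (windowʳ w ρ c h) (windowʳ w ρ c h′) y
    where
    windowˡ : ∀ w ρ c {y} → Window w ρ c (radius p ⊔ radius q) y → Window w ρ c (radius p) y
    windowˡ w ρ c = window-mono w ρ c (ℕₚ.m≤m⊔n (radius p) (radius q))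
    windowʳ : ∀ w ρ c {y} → Window w ρ c (radius p ⊔ radius q) y → Window w ρ c (radius q) y
    windowʳ w ρ c = window-mono w ρ c (ℕₚ.m≤n⊔m (radius p) (radius q))
    deMorgan : {X Y : Set} → Dec X → ¬ (X × Y) → ¬ X ⊎ ¬ Y
    deMorgan (yes x) f = inj₂ λ y → f (x , y)
    deMorgan (no n)  f = inj₁ n

  local-ren : {P : Unary n} (f : Fin n → Fin m) (g : ∀ w → Vec (Pos w) m → Vec (Pos w) n) →
    (∀ w ρ i → ρ at f i ≡ g w ρ at i) → IsLocal P → IsLocal (λ w ρ x → P w (g w ρ) x)
  local-ren {n = n} {m} {P} f g e p = local
    (moved {Q = At-head P} (yes-def p)) (moved {Q = λ w ρ → ¬ At-head P w ρ} (no-def p))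
    (radius p)
    λ w ρ c d s h h′ → uniform p w (g w ρ) c d s (window w ρ c h) (window w ρ c h′)
    where
    moved : {Q : Predicate (suc n)} → Def σ 2 Q → Def σ 2 (λ w ρ → Q w (ρ at zero ∷ g w (tail ρ)))
    moved {Q} = renᵈ {P = Q} (lift f) (λ w ρ → ρ at zero ∷ g w (tail ρ))
      λ { w (x ∷ ρ) zero → refl ; w (x ∷ ρ) (suc i) → e w ρ i }
    clear : ∀ w ρ c d k {y} → Clear w ρ c d k y → Clear w (g w ρ) c d k y
    clear w ρ c d zero    (a , b) = a , λ i q → b (f i) (trans q (sym (e w ρ i)))
    clear w ρ c d (suc k) ((a , b) , z , s , h) =
      (a , λ i q → b (f i) (trans q (sym (e w ρ i)))) , z , s , clear w ρ c d k h
    window : ∀ w ρ c {k y} → Window w ρ c k y → Window w (g w ρ) c k y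
    window w ρ c {k} h d = clear w ρ c d k (h d)

  Next : Direction → Unary n → Unary n
  Next d P w ρ x = Σ[ y ∈ Pos w ] (Succ d x y × P w ρ y)

  under : {P : Predicate (suc n)} → Def σ 2 P → Def σ 2 (λ w ρ → P w (ρ at zero ∷ tail (tail ρ)))
  under {P = P} = renᵈ {P = P} (λ { zero → zero ; (suc i) → suc (suc i) }) (λ w ρ → ρ at zero ∷ tail (tail ρ))
    λ { w (y ∷ x ∷ ρ) zero → refl ; w (y ∷ x ∷ ρ) (suc i) → refl }

  -- The neighbours of two adjacent positions are again adjacent, in the same direction; their
  -- windows are smaller by one, which is where the larger radius comes from.
  local-next : ∀ d → IsLocal P → IsLocal (Next d P)
  local-next {P = P} d p = local
    (∃ᵈ (succ-def d (suc zero) zero σ ∧ᵈ under {P = At-head P} (yes-def p)))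
    (cast (λ { w o (x ∷ ρ) → mk⇔
        (λ { (inj₁ edge) (y , s , h) → edge y (proj₁ s)
           ; (inj₂ (y , s , n)) (z , t , h) → n (subst (P w ρ) (succ-unique d t s) h) })
        (λ n → none w ρ x n (neighbour d x)) })
      (edge-def d zero σ ∨ᵈ ∃ᵈ (succ-def d (suc zero) zero σ ∧ᵈ under {P = λ w ρ → ¬ At-head P w ρ} (no-def p))))
    (suc (radius p))
    (λ w ρ c d′ {y} {z} s h h′ (t , r , x) → moved w ρ c d′ s r h h′ x (h′ d))
    where
    none : ∀ w ρ x → ¬ Next d P w ρ x → Edge d x ⊎ (Σ[ y ∈ Pos w ] Succ d x y) →
      Edge d x ⊎ (Σ[ y ∈ Pos w ] (Succ d x y × ¬ P w ρ y))
    none w ρ x n (inj₁ edge)    = inj₁ edge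
    none w ρ x n (inj₂ (y , s)) = inj₂ (y , s , λ h → n (y , s , h))
    parallel : ∀ {n} d d′ {y z t t′ : Fin n} → Succ d′ y z → Succ d y t → Succ d z t′ → Succ d′ t t′
    parallel fwd fwd s r r′ with succ-unique fwd s r
    ... | refl = r′
    parallel bwd bwd s r r′ with succ-unique bwd s r
    ... | refl = r′
    parallel fwd bwd s r r′ with succ-unique fwd (succ-op bwd s) r′
    ... | refl = succ-op fwd r
    parallel bwd fwd s r r′ with succ-unique bwd (succ-op fwd s) r′
    ... | refl = succ-op bwd r
    moved : ∀ w ρ c d′ {y z t} → Succ d′ y z → Succ d y t → Window w ρ c (suc (radius p)) y →
      Window w ρ c (suc (radius p)) z → P w ρ t → Clear w ρ c d (suc (radius p)) z → Next d P w ρ z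
    moved w ρ c d′ s r h h′ x (_ , t′ , r′ , _) = t′ , r′ ,
      uniform p w ρ c d′ (parallel d d′ s r r′) (window-step w ρ c d (radius p) h r) (window-step w ρ c d (radius p) h′ r′) x

  Until : Direction → A → Unary n → Unary n
  Until d a P w ρ x = Σ[ y ∈ Pos w ] (Within d a w x y × P w ρ y)

  -- y ends the maximal range over which Until d a can look from x.
  Ends : Direction → A → (w : List A) → Pos w → Pos w → Set
  Ends d a w x y = Within d a w x y × (¬ lookup w y ≡ a ⊎ Edge d y)

  ends-exists : ∀ d a w x → Σ[ y ∈ Pos w ] Ends d a w x y
  ends-exists d a w x = go x (lt-wf (op d) x)
    where
    go : ∀ x → Acc (lt (op d)) x → Σ[ y ∈ Pos w ] Ends d a w x y
    go x (acc rs) with lookup w x ≟ a | neighbour d x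
    ... | no n  | _            = x , (le-refl d , λ z (p , q) → contradiction q p) , inj₁ n
    ... | yes e | inj₁ edge    = x , (le-refl d , λ z (p , q) → contradiction q p) , inj₂ edge
    ... | yes e | inj₂ (z , s) = let y , (p , f) , b = go z (rs (lt-op d (proj₁ s))) in
      y , (lt⇒le d (lt-le-trans d (proj₁ s) p) , λ t (q , r) → first t (le-split d q) r f) , b
      where
      first : ∀ t → x ≡ t ⊎ lt d x t → ∀ {y} → lt d t y → (∀ z′ → le d z z′ × lt d z′ y → lookup w z′ ≡ a) → lookup w t ≡ a
      first t (inj₁ refl) r f = e
      first t (inj₂ l)    r f = f t (succ-least d s l , r)

  module _ {n} {P : Unary n} (p : IsLocal P) (d : Direction) (a : A) where
    private
      D : ℕ
      -- A window of this size around a position leaves one of size `radius p` around its neighbour,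
      -- and uniformity asks for both.
      D = suc (radius p)

    Refuted : ∀ w → Vec (Pos w) n → Pos w → Pos w → Set
    Refuted w ρ x y = ¬ Within d a w x y ⊎ ¬ P w ρ y

    -- By uniformity a witness of Until d a P can be moved towards x until it
    -- is near x, near the end of its range or near a parameter.
    Landmarks-refuted : ∀ w → Vec (Pos w) n → Pos w → Pos w → Set
    Landmarks-refuted w ρ x e = ∀ i d′ y → Reach d′ D ((e ∷ x ∷ ρ) at i) y → Refuted w ρ x y

    -- A witness with a clear window moves one step towards `x` and remains a witness, so descent
    -- ends at `x` or at an obstacle within `D` steps. If the obstacle is a parameter, the witness
    -- is near it. If it is another letter or an edge of the word, then `e` lies between it and the
    -- witness when it is ahead, and `x` does when it is behind. In each case the witness is near a
    -- landmark, where it is refuted.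
    refute : ∀ w ρ x e → Ends d a w x e → Landmarks-refuted w ρ x e → ∀ y → Within d a w x y → ¬ P w ρ y
    refute w ρ x e ((x≤e , run-e) , end) L y run h = descend _ y (proj₂ (le⇒reach d (proj₁ run))) run h
      where
      near : ∀ {y} i d′ → Reach d′ D ((e ∷ x ∷ ρ) at i) y → Within d a w x y → P w ρ y → ⊥
      near i d′ r run h with L i d′ _ r
      ... | inj₁ n = n run
      ... | inj₂ n = n h
      near-end : ∀ {y} z → Reach d D y z → lookup w z ≢ a ⊎ Edge d z → Within d a w x y → P w ρ y → ⊥
      near-end {y} z r b run h = near zero (op d) (reach-op d (reach-between d r y≤e e≤z)) run h
        where
        y≤e : le d y e
        y≤e l = [ (λ n → n (proj₂ run e (x≤e , l))) , (λ edge → edge y l) ]′ end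
        e≤z : le d e z
        e≤z l = [ (λ n → n (run-e z (le-trans d (proj₁ run) (reach-le d r) , l))) , (λ edge → edge e l) ]′ b
      near-start : ∀ {y} z → Reach (op d) D y z → le d z x → Within d a w x y → P w ρ y → ⊥
      near-start z r l run h = near (suc zero) d (reach-op⁻ d (reach-between (op d) r
        (λ q → proj₁ run (lt-op⁻ d q)) (λ q → l (lt-op⁻ d q)))) run h
      obstacle : ∀ {y} d′ → d′ ≡ d ⊎ d′ ≡ op d → Obstacle w ρ a d′ D y → Within d a w x y → P w ρ y → ⊥
      obstacle d′ _ (z , r , inj₁ bad) run h with not-good w ρ a z bad
      obstacle d′ _ (z , r , inj₁ bad) run h | inj₂ (i , refl) = near (suc (suc i)) (op d′) (reach-op d′ r) run h
      obstacle _ (inj₁ refl) (z , r , inj₁ bad) run h | inj₁ ≢a = near-end z r (inj₁ ≢a) run h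
      -- A wrong letter behind `y` cannot lie strictly between `x` and `y`. It may be at `y` itself,
      -- because a run excludes its last position; then `y` is the end of the range.
      obstacle {y} _ (inj₂ refl) (z , r , inj₁ bad) run h | inj₁ ≢a with lt-cmp d x z
      ... | inj₂ (inj₁ refl) = near-start z r (le-refl d) run h
      ... | inj₂ (inj₂ l)    = near-start z r (lt⇒le d l) run h
      ... | inj₁ l with le-split {x = z} {y = y} d (λ q → reach-le (op d) r (lt-op d q))
      ... | inj₁ refl = near-end z here (inj₁ ≢a) run h
      ... | inj₂ l′   = ≢a (proj₂ run z (lt⇒le d l , l′))
      obstacle _ (inj₁ refl) (z , r , inj₂ edge) run h = near-end z r (inj₂ edge) run h
      obstacle _ (inj₂ refl) (z , r , inj₂ edge) run h = near-start z r (λ q → edge x (lt-op d q)) run h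
      cases : ∀ d d′ → d′ ≡ d ⊎ d′ ≡ op d
      cases fwd fwd = inj₁ refl
      cases fwd bwd = inj₂ refl
      cases bwd fwd = inj₂ refl
      cases bwd bwd = inj₁ refl
      descend : ∀ k y → Reach d k x y → Within d a w x y → P w ρ y → ⊥
      descend k y r run h with reach-last d r
      ... | inj₁ refl = near (suc zero) d here run h
      ... | inj₂ (l , z , refl , r′ , s) with clear? w ρ a fwd D y | clear? w ρ a bwd D y
      ... | inj₂ o | _      = obstacle fwd (cases d fwd) o run h
      ... | inj₁ _ | inj₂ o = obstacle bwd (cases d bwd) o run h
      ... | inj₁ f | inj₁ b = descend l z r′
        (reach-le d r′ , λ t (q , q′) → proj₂ run t (q , lt-trans d q′ (proj₁ s)))
        (uniform p w ρ a (op d) (succ-op d s) (window-mono w ρ a (ℕₚ.n≤1+n (radius p)) win)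
          (window-step w ρ a (op d) (radius p) win (succ-op d s)) h)
        where
        win : Window w ρ a D y
        win fwd = f
        win bwd = b

    refuted-def : Def σ 2 (λ w ρ → Refuted w (tail (tail (tail ρ))) (ρ at suc (suc zero)) (ρ at zero))
    refuted-def = (¬ᵈ within-def d a (suc (suc zero)) zero π)
      ∨ᵈ renᵈ {P = λ w ρ → ¬ At-head P w ρ} (λ { zero → zero ; (suc i) → suc (suc (suc i)) })
           (λ w ρ → ρ at zero ∷ tail (tail (tail ρ)))
           (λ { w (y ∷ e ∷ x ∷ ρ) zero → refl ; w (y ∷ e ∷ x ∷ ρ) (suc i) → refl }) (no-def p)

    landmarks-def : Def σ 2 (λ w ρ → Landmarks-refuted w (tail (tail ρ)) (ρ at suc zero) (ρ at zero))
    landmarks-def = cast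
      (λ { w o (e ∷ x ∷ ρ) → mk⇔ (λ { h i fwd → proj₁ (h i) ; h i bwd → proj₂ (h i) }) (λ f i → f i fwd , f i bwd) })
      (every (suc (suc n)) λ i → reach-def {Q = Body} refuted-def fwd D i ∧ᵈ reach-def {Q = Body} refuted-def bwd D i)
      where
      Body : Predicate (suc (suc (suc n)))
      Body w ρ = Refuted w (tail (tail (tail ρ))) (ρ at suc (suc zero)) (ρ at zero)

    -- The complement would be a universal statement about Σ₂ conditions. Guessing the end of the
    -- range and checking the finitely many positions near landmarks makes it Σ₂. As to uniformity,
    -- a witness beyond the position also serves its neighbour, and a witness at the position itself
    -- is moved along with it.
    local-until : IsLocal (Until d a P)
    local-until = local
      (∃ᵈ (within-def d a (suc zero) zero σ ∧ᵈ under {P = At-head P} (yes-def p)))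
      (cast (λ { w o (x ∷ ρ) → mk⇔
          (λ { (e , end , L) (y , run , h) → refute w ρ x e end L y run h })
          (λ n → let e , end = ends-exists d a w x in e , end , λ i d′ y r → refuted w ρ x y n) })
        (∃ᵈ ((within-def d a (suc zero) zero σ ∧ᵈ ((¬ᵈ letter-def a zero π 2) ∨ᵈ edge-def d zero σ)) ∧ᵈ landmarks-def)))
      (radius p)
      uniformly
      where
      refuted : ∀ w ρ x y → ¬ Until d a P w ρ x → Refuted w ρ x y
      refuted w ρ x y n with local? p w ρ y
      ... | yes h = inj₁ λ run → n (y , run , h)
      ... | no h  = inj₂ h
      uniformly : ∀ w ρ c d′ {y z} → Succ d′ y z → Window w ρ c (radius p) y → Window w ρ c (radius p) z →
        Until d a P w ρ y → Until d a P w ρ z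
      uniformly w ρ c d′ {y} {z} s h h′ (t , (l , run) , x) with le-split d l
      ... | inj₁ refl = z , (le-refl d , λ t (q , q′) → contradiction q′ q) , uniform p w ρ c d′ s h h′ x
      ... | inj₂ y<t = t , shift d d′ refl s , x
        where
        z≡a : lookup w z ≡ a
        z≡a = trans (proj₁ (window-good w ρ c (radius p) h′))
          (trans (sym (proj₁ (window-good w ρ c (radius p) h))) (run y (le-refl d , y<t)))
        forward : Succ d y z → Within d a w z t
        forward s = succ-least d s y<t , λ r (q , q′) → run r (lt⇒le d (lt-le-trans d (proj₁ s) q) , q′)
        backward : Succ d z y → Within d a w z t
        backward s = lt⇒le d (lt-trans d (proj₁ s) y<t) , λ r (q , q′) → from-z r (le-split d q) q′
          where
          from-z : ∀ r → z ≡ r ⊎ lt d z r → lt d r t → lookup w r ≡ a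
          from-z r (inj₁ refl) _  = z≡a
          from-z r (inj₂ l)    q′ = run r (succ-least d s l , q′)
        shift : ∀ d₀ d′ → d₀ ≡ d → Succ d′ y z → Within d a w z t
        shift fwd fwd refl s = forward s
        shift bwd bwd refl s = forward s
        shift fwd bwd refl s = backward (succ-op bwd s)
        shift bwd fwd refl s = backward (succ-op fwd s)

-- Two letters

-- A walk against `d` through failures ends where the preceding position satisfies `Q` or where the
-- word begins. For a property that is monotone along `d` this is the only boundary.
first-failure : ∀ d {Q : Fin n → Set} → (∀ x → Dec (Q x)) → ∀ x → ¬ Q x →
  Σ[ c ∈ Fin n ] (¬ Q c × (Edge (op d) c ⊎ (Σ[ y ∈ Fin n ] (Succ d y c × Q y))))
first-failure {n} d {Q} Q? x ¬q = go x ¬q (lt-wf d x)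
  where
  go : ∀ x → ¬ Q x → Acc (lt d) x → Σ[ c ∈ Fin n ] (¬ Q c × (Edge (op d) c ⊎ (Σ[ y ∈ Fin n ] (Succ d y c × Q y))))
  go x ¬q (acc rs) with neighbour (op d) x
  ... | inj₁ edge = x , ¬q , inj₁ edge
  ... | inj₂ (y , s) with Q? y
  ... | yes q = x , ¬q , inj₂ (y , succ-op⁻ d s , q)
  ... | no ¬q′ = go y ¬q′ (rs (proj₁ (succ-op⁻ d s)))

final : ∀ d → Fin n → Σ[ x ∈ Fin n ] Edge d x
final {n} d x = go x (lt-wf (op d) x)
  where
  go : ∀ x → Acc (lt (op d)) x → Σ[ x ∈ Fin n ] Edge d x
  go x (acc rs) with neighbour d x
  ... | inj₁ edge    = x , edge
  ... | inj₂ (y , s) = go y (rs (lt-op d (proj₁ s)))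


module Binary {A : Set} (_≟_ : DecidableEquality A) (a₀ a₁ : A) (a₀≢a₁ : a₀ ≢ a₁)
  (two : ∀ a → a ≡ a₀ ⊎ a ≡ a₁) where

  open Definability _≟_
  open Local _≟_

  -- Modal formulas and the guessing of thresholds.

  data Modal : Set where
    letter  : A → Modal
    true    : Modal
    not     : Modal → Modal
    _∧_     : Modal → Modal → Modal
    next    : Direction → Modal → Modal
    until   : Direction → A → Modal → Modal
    far     : Direction → Modal → Modal

  Has : Direction → A → (w : List A) → Pos w → Pos w → Set
  Has d a w x y = Σ[ z ∈ Pos w ] (lt d x z × lt d z y × lookup w z ≡ a)

  Far : Direction → (w : List A) → Pos w → Pos w → Set
  Far d w x y = lt d x y × Has d a₀ w x y × Has d a₁ w x y

  infix 4 _,_⊨_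
  _,_⊨_ : (w : List A) → Pos w → Modal → Set
  w , x ⊨ letter a    = lookup w x ≡ a
  w , x ⊨ true        = ⊤
  w , x ⊨ not α       = ¬ (w , x ⊨ α)
  w , x ⊨ α ∧ β       = (w , x ⊨ α) × (w , x ⊨ β)
  w , x ⊨ next d α    = Σ[ y ∈ Pos w ] (Succ d x y × (w , y ⊨ α))
  w , x ⊨ until d a α = Σ[ y ∈ Pos w ] (Within d a w x y × (w , y ⊨ α))
  w , x ⊨ far d α     = Σ[ y ∈ Pos w ] (Far d w x y × (w , y ⊨ α))

  has-def : ∀ d a (x y : Fin n) s → Def s 2 (λ w ρ → Has d a w (ρ at x) (ρ at y))
  has-def d a x y s = raised σ s
    (∃ᵈ (lt-def d (suc x) zero σ 1 ∧ᵈ lt-def d zero (suc y) σ 1 ∧ᵈ letter-def a zero σ 1))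

  far-def : ∀ d (x y : Fin n) s → Def s 2 (λ w ρ → Far d w (ρ at x) (ρ at y))
  far-def d x y s = lt-def d x y s 2 ∧ᵈ has-def d a₀ x y s ∧ᵈ has-def d a₁ x y s

  modal? : ∀ w x α → Dec (w , x ⊨ α)
  modal? w x (letter a)    = lookup w x ≟ a
  modal? w x true          = yes tt
  modal? w x (not α)       = ¬? (modal? w x α)
  modal? w x (α ∧ β)       = modal? w x α ×-dec modal? w x β
  modal? w x (next d α)    = any? λ y → def? (succ-def d zero (suc zero) σ) w x (x ∷ y ∷ []) ×-dec modal? w y α
  modal? w x (until d a α) = any? λ y → def? (within-def d a zero (suc zero) σ) w x (x ∷ y ∷ []) ×-dec modal? w y α
  modal? w x (far d α)     = any? λ y → def? (far-def d zero (suc zero) σ) w x (x ∷ y ∷ []) ×-dec modal? w y α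

  has-mono : ∀ d {a} w {x y z} → le d x y → Has d a w y z → Has d a w x z
  has-mono d w p (t , q , r , e) = t , le-lt-trans d p q , r , e

  far-mono : ∀ d w {x y z} → le d x y → Far d w y z → Far d w x z
  far-mono d w p (l , h , h′) = le-lt-trans d p l , has-mono d w p h , has-mono d w p h′

  -- `correct` holds for every vector that meets `Params`, not just for the one provided by
  -- `exists`. So a guess can be used under negation, and `Property` may stand in for `α` at all
  -- positions at once.
  record Eliminated (α : Modal) : Set₁ where
    field
      arity     : ℕ
      Params    : Predicate arity
      Property  : Unary arity
      params-def : Def π 2 Params
      is-local  : IsLocal Property
      correct   : ∀ w ρ x → Params w ρ → (w , x ⊨ α) ⇔ Property w ρ x
      exists    : ∀ w → Pos w → Σ[ ρ ∈ Vec (Pos w) arity ] Params w ρ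

  rigid : ∀ {α} {P : Unary 0} → IsLocal P → (∀ w x → (w , x ⊨ α) ⇔ P w [] x) → Eliminated α
  rigid {P = P} p h = record
    { arity = 0 ; Params = λ w ρ → ⊤ ; Property = P ; params-def = qf-def π 2 true ; is-local = p
    ; correct = λ { w [] x _ → h w x } ; exists = λ w o → [] , tt }

  under-modality : ∀ {α β} (e : Eliminated α) (let open Eliminated e) {P : Unary arity} → IsLocal P →
    (∀ w ρ → (∀ x → (w , x ⊨ α) ⇔ Property w ρ x) → ∀ x → (w , x ⊨ β) ⇔ P w ρ x) → Eliminated β
  under-modality e {P} p h = record
    { arity = arity ; Params = Params ; Property = P ; params-def = params-def ; is-local = p
    ; correct = λ w ρ x c → h w ρ (λ x → correct w ρ x c) x ; exists = exists }
    where open Eliminated e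

  module _ {X : Set} where
    prefix : ∀ m → Vec X (m + n) → Vec X m
    prefix zero    ρ       = []
    prefix (suc m) (x ∷ ρ) = x ∷ prefix m ρ

    suffix : ∀ m → Vec X (m + n) → Vec X n
    suffix zero    ρ       = ρ
    suffix (suc m) (x ∷ ρ) = suffix m ρ

    at-prefix : ∀ m (ρ : Vec X (m + n)) (i : Fin m) → ρ at (i ↑ˡ n) ≡ prefix m ρ at i
    at-prefix (suc m) (x ∷ ρ) zero    = refl
    at-prefix (suc m) (x ∷ ρ) (suc i) = at-prefix m ρ i

    at-suffix : ∀ m (ρ : Vec X (m + n)) (i : Fin n) → ρ at (m ↑ʳ i) ≡ suffix m ρ at i
    at-suffix zero    ρ       i = refl
    at-suffix (suc m) (x ∷ ρ) i = at-suffix m ρ i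

    prefix-++ : ∀ {m} (ρ : Vec X m) (ρ′ : Vec X n) → prefix m (ρ ++ᵛ ρ′) ≡ ρ
    prefix-++ []      ρ′ = refl
    prefix-++ (x ∷ ρ) ρ′ = cong (x ∷_) (prefix-++ ρ ρ′)

    suffix-++ : ∀ {m} (ρ : Vec X m) (ρ′ : Vec X n) → suffix m (ρ ++ᵛ ρ′) ≡ ρ′
    suffix-++ []      ρ′ = refl
    suffix-++ (x ∷ ρ) ρ′ = suffix-++ ρ ρ′

  eliminate-∧ : ∀ {α β} → Eliminated α → Eliminated β → Eliminated (α ∧ β)
  eliminate-∧ e f = record
    { arity = E.arity + F.arity
    ; Params = λ w ρ → E.Params w (prefix E.arity ρ) × F.Params w (suffix E.arity ρ)
    ; Property = λ w ρ x → E.Property w (prefix E.arity ρ) x × F.Property w (suffix E.arity ρ) x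
    ; params-def = renᵈ {P = E.Params} (_↑ˡ F.arity) (λ w → prefix E.arity) (λ w → at-prefix E.arity) E.params-def
        ∧ᵈ renᵈ {P = F.Params} (E.arity ↑ʳ_) (λ w → suffix E.arity) (λ w → at-suffix E.arity) F.params-def
    ; is-local = local-and
        (local-ren {P = E.Property} (_↑ˡ F.arity) (λ w → prefix E.arity) (λ w → at-prefix E.arity) E.is-local)
        (local-ren {P = F.Property} (E.arity ↑ʳ_) (λ w → suffix E.arity) (λ w → at-suffix E.arity) F.is-local)
    ; correct = λ { w ρ x (c , c′) → E.correct w _ x c ×-⇔ F.correct w _ x c′ }
    ; exists = λ w o → let ρ , c = E.exists w o ; ρ′ , c′ = F.exists w o in ρ ++ᵛ ρ′
        , subst (E.Params w) (sym (prefix-++ ρ ρ′)) c , subst (F.Params w) (sym (suffix-++ ρ ρ′)) c′ }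
    where
    module E = Eliminated e
    module F = Eliminated f

  -- far d α holds exactly at the positions before some c.  That c is the first
  -- failure of far d α is witnessed by its predecessor y and a position z with
  -- Far d w y z where α holds, which keeps the parameters Π₂-definable.
  module _ (d : Direction) {α : Modal} (e : Eliminated α) where
    open Eliminated e
    private
      tail³ : ∀ {X : Set} {n} → Vec X (3 + n) → Vec X n
      tail³ ρ = tail (tail (tail ρ))

    FarParams : Predicate (3 + arity)
    FarParams w ρ = Params w (tail³ ρ)
      × (∀ t → Far d w (ρ at zero) t → ¬ Property w (tail³ ρ) t)
      × (Edge (op d) (ρ at zero)
         ⊎ (Succ d (ρ at suc zero) (ρ at zero) × Far d w (ρ at suc zero) (ρ at suc (suc zero))
            × Property w (tail³ ρ) (ρ at suc (suc zero))))

    -- Both halves of locality are spent here. Under the universal quantifier `Property` is negated,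
    -- and its Σ₂ definition becomes Π₂; for the witness beyond the threshold it occurs positively,
    -- and its Π₂ form comes from the Σ₂ definition of the complement.
    far-params-def : Def π 2 FarParams
    far-params-def =
      renᵈ {P = Params} (λ i → suc (suc (suc i))) (λ w → tail³) (λ { w (c ∷ y ∷ z ∷ ρ) i → refl }) params-def
      ∧ᵈ ∀ᵈ (far-def d (suc zero) zero σ →ᵈ (¬ᵈ renᵈ {P = At-head Property}
            (λ { zero → zero ; (suc i) → suc (suc (suc (suc i))) }) (λ w ρ → ρ at zero ∷ tail³ (tail ρ))
            (λ { w (t ∷ c ∷ y ∷ z ∷ ρ) zero → refl ; w (t ∷ c ∷ y ∷ z ∷ ρ) (suc i) → refl }) (yes-def is-local)))
      ∧ᵈ (edge-def (op d) zero π
          ∨ᵈ succ-def d (suc zero) zero π ∧ᵈ far-def d (suc zero) (suc (suc zero)) π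
             ∧ᵈ renᵈ {P = At-head Property} (λ { zero → suc (suc zero) ; (suc i) → suc (suc (suc i)) })
                  (λ w ρ → ρ at suc (suc zero) ∷ tail³ ρ)
                  (λ { w (c ∷ y ∷ z ∷ ρ) zero → refl ; w (c ∷ y ∷ z ∷ ρ) (suc i) → refl }) (yes-defᵖ is-local))

    far-threshold : ∀ w ρ x → FarParams w ρ → (w , x ⊨ far d α) ⇔ lt d x (ρ at zero)
    far-threshold w (c ∷ y ∷ z ∷ ρ) x (P , fails , first) = mk⇔ below (above first)
      where
      below : (w , x ⊨ far d α) → lt d x c
      below (t , f , h) with lt-cmp d x c
      ... | inj₁ l           = l
      ... | inj₂ (inj₁ refl) = ⊥-elim (fails t f (to (correct w ρ t P) h))
      ... | inj₂ (inj₂ l)    = ⊥-elim (fails t (far-mono d w (lt⇒le d l) f) (to (correct w ρ t P) h))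
      above : Edge (op d) c ⊎ (Succ d y c × Far d w y z × Property w ρ z) → lt d x c → (w , x ⊨ far d α)
      above (inj₁ edge)        l = contradiction (lt-op d l) (edge x)
      above (inj₂ (s , f , h)) l = z , far-mono d w (succ-greatest d s l) f , from (correct w ρ z P) h

    far-exists : ∀ w → Pos w → Σ[ ρ ∈ Vec (Pos w) (3 + arity) ] FarParams w ρ
    far-exists w o with exists w o | final d o
    ... | ρ , P | l , edge with first-failure d (λ x → modal? w x (far d α)) l (λ { (t , f , _) → edge t (proj₁ f) })
    ... | c , n , inj₁ edge′ =
      -- When the threshold is at the edge no witness is called for, and the last two copies of `c`
      -- are placeholders.
      c ∷ c ∷ c ∷ ρ , P , (λ t f h → n (t , f , from (correct w ρ t P) h)) , inj₁ edge′
    ... | c , n , inj₂ (y , s , z , f , h) =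
      c ∷ y ∷ z ∷ ρ , P , (λ t f h → n (t , f , from (correct w ρ t P) h)) , inj₂ (s , f , to (correct w ρ z P) h)

    eliminate-far : Eliminated (far d α)
    eliminate-far = record
      { arity = 3 + arity ; Params = FarParams ; Property = λ w ρ x → lt d x (ρ at zero)
      ; params-def = far-params-def ; is-local = local-cut d zero ; correct = far-threshold ; exists = far-exists }

  eliminate : ∀ α → Eliminated α
  eliminate (letter a)    = rigid (local-letter a) λ w x → ⇔-refl
  eliminate true          = rigid local-true λ w x → ⇔-refl
  eliminate (not α)       = let e = eliminate α in
    under-modality e (local-not (Eliminated.is-local e)) λ w ρ h x → ¬-⇔ (h x)
  eliminate (α ∧ β)       = eliminate-∧ (eliminate α) (eliminate β)
  eliminate (next d α)    = let e = eliminate α in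
    under-modality e (local-next d (Eliminated.is-local e)) λ w ρ h x → ∃-⇔ λ y → ⇔-refl ×-⇔ h y
  eliminate (until d a α) = let e = eliminate α in
    under-modality e (local-until (Eliminated.is-local e) d a) λ w ρ h x → ∃-⇔ λ y → ⇔-refl ×-⇔ h y
  eliminate (far d α)     = eliminate-far d (eliminate α)

  -- From two-variable formulas to modal formulas.

  infixr 6 _or_
  _or_ : Modal → Modal → Modal
  α or β = not (not α ∧ not β)

  or-sat : ∀ {w x} α β → (w , x ⊨ α or β) ⇔ ((w , x ⊨ α) ⊎ (w , x ⊨ β))
  or-sat {w} {x} α β = mk⇔ choose (λ { (inj₁ h) (n , _) → n h ; (inj₂ h) (_ , n) → n h })
    where
    choose : (w , x ⊨ α or β) → (w , x ⊨ α) ⊎ (w , x ⊨ β)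
    choose f with modal? w x α | modal? w x β
    ... | yes h | _     = inj₁ h
    ... | no _  | yes h = inj₂ h
    ... | no n  | no n′ = ⊥-elim (f (n , n′))

  -- The mutual position of two positions: equal, or in the given direction
  -- with a₀, resp. a₁, strictly between them or not.
  data Shape : Set where
    same  : Shape
    apart : Direction → Bool → Bool → Shape

  Occurs : Bool → Set → Set
  Occurs true  X = X
  Occurs false X = ¬ X

  Holds : Shape → (w : List A) → Pos w → Pos w → Set
  Holds same            w x y = x ≡ y
  Holds (apart d b₀ b₁) w x y = lt d x y × Occurs b₀ (Has d a₀ w x y) × Occurs b₁ (Has d a₁ w x y)

  has? : ∀ d a w x y → Dec (Has d a w x y)
  has? d a w x y = def? (has-def d a zero (suc zero) σ) w x (x ∷ y ∷ [])

  occurs : {X : Set} → Dec X → Σ[ b ∈ Bool ] Occurs b X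
  occurs (yes x) = true , x
  occurs (no n)  = false , n

  apart-shape : ∀ d w x y → lt d x y → Σ[ s ∈ Shape ] Holds s w x y
  apart-shape d w x y l =
    let b₀ , h₀ = occurs (has? d a₀ w x y) ; b₁ , h₁ = occurs (has? d a₁ w x y) in apart d b₀ b₁ , l , h₀ , h₁

  shape : ∀ w x y → Σ[ s ∈ Shape ] Holds s w x y
  shape w x y with lt-cmp fwd x y
  ... | inj₁ l        = apart-shape fwd w x y l
  ... | inj₂ (inj₁ e) = same , e
  ... | inj₂ (inj₂ l) = apart-shape bwd w x y l

  mirror : Shape → Shape
  mirror same            = same
  mirror (apart d b₀ b₁) = apart (op d) b₀ b₁

  has-op : ∀ d a w x y → Has d a w x y ⇔ Has (op d) a w y x
  has-op fwd a w x y = mk⇔ (λ { (z , p , q , e) → z , q , p , e }) (λ { (z , p , q , e) → z , q , p , e })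
  has-op bwd a w x y = mk⇔ (λ { (z , p , q , e) → z , q , p , e }) (λ { (z , p , q , e) → z , q , p , e })

  occurs-⇔ : ∀ b {X Y : Set} → X ⇔ Y → Occurs b X → Occurs b Y
  occurs-⇔ true  h = to h
  occurs-⇔ false h = to (¬-⇔ h)

  mirrored : ∀ s w x y → Holds s w x y → Holds (mirror s) w y x
  mirrored same            w x y e = sym e
  mirrored (apart d b₀ b₁) w x y (l , h₀ , h₁) =
    lt-op d l , occurs-⇔ b₀ (has-op d a₀ w x y) h₀ , occurs-⇔ b₁ (has-op d a₁ w x y) h₁

  -- Without `b`, the interval consists of letters `a` only. Its first position `y` is named
  -- separately, to make sure that there is one; the run then starts at the successor of `y`, which
  -- may already be `t`.
  run-⇔ : ∀ d {a b} → a ≢ b → (∀ c → c ≡ a ⊎ c ≡ b) → ∀ w x t →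
    (lt d x t × Has d a w x t × ¬ Has d b w x t) ⇔
    (Σ[ y ∈ Pos w ] (Succ d x y × lookup w y ≡ a × (Σ[ z ∈ Pos w ] (Succ d y z × Within d a w z t))))
  run-⇔ d {a} {b} a≢b cover w x t = mk⇔
    (λ { (l , (q , x<q , q<t , _) , none) → split l x<q q<t none (neighbour d x) })
    (λ { (y , s , e , z , s′ , z≤t , run) →
      let y<t = lt-le-trans d (proj₁ s′) z≤t in
      lt-trans d (proj₁ s) y<t , (y , proj₁ s , y<t , e)
      , λ { (r , p , q , e′) → a≢b (trans (sym (letters e s s′ run r p q)) e′) } })
    where
    only-a : ¬ Has d b w x t → ∀ r → lt d x r → lt d r t → lookup w r ≡ a
    only-a none r p q = [ (λ e → e) , (λ e → ⊥-elim (none (r , p , q , e))) ]′ (cover (lookup w r))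
    Split : Set
    Split = Σ[ y ∈ Pos w ] (Succ d x y × lookup w y ≡ a × (Σ[ z ∈ Pos w ] (Succ d y z × Within d a w z t)))
    split : ∀ {q} → lt d x t → lt d x q → lt d q t → ¬ Has d b w x t → Edge d x ⊎ (Σ[ y ∈ Pos w ] Succ d x y) → Split
    split l x<q q<t none (inj₁ edge) = contradiction l (edge _)
    split l x<q q<t none (inj₂ (y , s)) with neighbour d y
    ... | inj₁ edge     = contradiction (le-lt-trans d (succ-least d s x<q) q<t) (edge _)
    ... | inj₂ (z , s′) = let y<t = le-lt-trans d (succ-least d s x<q) q<t in
      y , s , only-a none y (proj₁ s) y<t , z , s′ , succ-least d s′ y<t
      , λ r (p , q) → only-a none r (lt-trans d (proj₁ s) (lt-le-trans d (proj₁ s′) p)) q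
    letters : ∀ {y z} → lookup w y ≡ a → Succ d x y → Succ d y z → (∀ r → le d z r × lt d r t → lookup w r ≡ a) →
      ∀ r → lt d x r → lt d r t → lookup w r ≡ a
    letters e s s′ run r p q with le-split d (succ-least d s p)
    ... | inj₁ refl = e
    ... | inj₂ l    = run r (succ-least d s′ l , q)

  run-formula : Direction → A → Modal → Modal
  run-formula d a α = next d (letter a ∧ next d (until d a α))

  run-sat : ∀ d {a b} → a ≢ b → (∀ c → c ≡ a ⊎ c ≡ b) → ∀ w x α → (w , x ⊨ run-formula d a α) ⇔
    (Σ[ t ∈ Pos w ] ((lt d x t × Has d a w x t × ¬ Has d b w x t) × (w , t ⊨ α)))
  run-sat d a≢b cover w x α = mk⇔
    (λ { (y , s , e , z , s′ , t , run , h) → t , from (run-⇔ d a≢b cover w x t) (y , s , e , z , s′ , run) , h })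
    (λ { (t , p , h) → let y , s , e , z , s′ , run = to (run-⇔ d a≢b cover w x t) p in
      y , s , e , z , s′ , t , run , h })

  -- With two letters, an interval free of both is empty and one free of a single letter is a run.
  -- Only the last shape reaches an unbounded and varied part of the word.
  ◇ : Shape → Modal → Modal
  ◇ same                  α = α
  ◇ (apart d false false) α = next d α
  ◇ (apart d true  false) α = run-formula d a₀ α
  ◇ (apart d false true)  α = run-formula d a₁ α
  ◇ (apart d true  true)  α = far d α

  ◇-sat : ∀ s {w x} α → (w , x ⊨ ◇ s α) ⇔ (Σ[ y ∈ Pos w ] (Holds s w x y × (w , y ⊨ α)))
  ◇-sat same {w} {x} α = mk⇔ (λ h → x , refl , h) (λ { (_ , refl , h) → h })
  ◇-sat (apart d false false) {w} {x} α = ∃-⇔ λ y → mk⇔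
    (λ { (l , f) → l , (λ { (z , p , q , _) → f z (p , q) }) , (λ { (z , p , q , _) → f z (p , q) }) })
    (λ { (l , n₀ , n₁) → l , λ { z (p , q) →
      [ (λ e → n₀ (z , p , q , e)) , (λ e → n₁ (z , p , q , e)) ]′ (two (lookup w z)) } })
    ×-⇔ ⇔-refl
  ◇-sat (apart d true false) {w} {x} α = run-sat d a₀≢a₁ two w x α
  ◇-sat (apart d false true) {w} {x} α =
    (∃-⇔ λ y → mk⇔ (λ { (l , p , q) → l , q , p }) (λ { (l , p , q) → l , q , p }) ×-⇔ ⇔-refl)
    ⇔-∘ run-sat d (λ e → a₀≢a₁ (sym e)) (λ c → [ inj₂ , inj₁ ]′ (two c)) w x α
  ◇-sat (apart d true true) α = ⇔-refl

  some-direction : (Direction → Modal) → Modal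
  some-direction f = f fwd or f bwd

  some-bool : (Bool → Modal) → Modal
  some-bool f = f true or f false

  some-shape : (Shape → Modal) → Modal
  some-shape f = f same or some-direction λ d → some-bool λ b₀ → some-bool λ b₁ → f (apart d b₀ b₁)

  some-direction-sat : ∀ w x f → (w , x ⊨ some-direction f) ⇔ (Σ[ d ∈ Direction ] (w , x ⊨ f d))
  some-direction-sat w x f = mk⇔
    (λ h → [ (λ h → fwd , h) , (λ h → bwd , h) ]′ (to (or-sat {w} {x} (f fwd) (f bwd)) h))
    (λ { (fwd , h) → from (or-sat {w} {x} (f fwd) (f bwd)) (inj₁ h)
       ; (bwd , h) → from (or-sat {w} {x} (f fwd) (f bwd)) (inj₂ h) })

  some-bool-sat : ∀ w x f → (w , x ⊨ some-bool f) ⇔ (Σ[ b ∈ Bool ] (w , x ⊨ f b))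
  some-bool-sat w x f = mk⇔
    (λ h → [ (λ h → true , h) , (λ h → false , h) ]′ (to (or-sat {w} {x} (f true) (f false)) h))
    (λ { (true , h)  → from (or-sat {w} {x} (f true) (f false)) (inj₁ h)
       ; (false , h) → from (or-sat {w} {x} (f true) (f false)) (inj₂ h) })

  some-shape-sat : ∀ w x f → (w , x ⊨ some-shape f) ⇔ (Σ[ s ∈ Shape ] (w , x ⊨ f s))
  some-shape-sat w x f = mk⇔
    (λ h → [ (λ h → same , h) , apart-case ]′ (to (or-sat {w} {x} (f same) f₀) h))
    (λ { (same , h) → from (or-sat {w} {x} (f same) f₀) (inj₁ h)
       ; (apart d b₀ b₁ , h) → from (or-sat {w} {x} (f same) f₀) (inj₂ (from (some-direction-sat w x f₁)
           (d , from (some-bool-sat w x (f₂ d)) (b₀ , from (some-bool-sat w x (f₃ d b₀)) (b₁ , h))))) })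
    where
    f₃ : Direction → Bool → Bool → Modal
    f₃ d b₀ b₁ = f (apart d b₀ b₁)
    f₂ : Direction → Bool → Modal
    f₂ d b₀ = some-bool (f₃ d b₀)
    f₁ : Direction → Modal
    f₁ d = some-bool (f₂ d)
    f₀ : Modal
    f₀ = some-direction f₁
    apart-case : (w , x ⊨ f₀) → Σ[ s ∈ Shape ] (w , x ⊨ f s)
    apart-case h with to (some-direction-sat w x f₁) h
    ... | d , h with to (some-bool-sat w x (f₂ d)) h
    ... | b₀ , h with to (some-bool-sat w x (f₃ d b₀)) h
    ... | b₁ , h = apart d b₀ b₁ , h

  -- A finite union of rectangles: each pair constrains the two positions separately.
  Rectangles : Set
  Rectangles = List (Modal × Modal)

  Covers : (w : List A) → Pos w → Pos w → Rectangles → Set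
  Covers w x y []            = ⊥
  Covers w x y ((α , β) ∷ D) = ((w , x ⊨ α) × (w , y ⊨ β)) ⊎ Covers w x y D

  covers? : ∀ w x y D → Dec (Covers w x y D)
  covers? w x y []            = no λ ()
  covers? w x y ((α , β) ∷ D) = (modal? w x α ×-dec modal? w y β) ⊎-dec covers? w x y D

  covers-++ : ∀ w x y D E → Covers w x y (D ++ E) ⇔ (Covers w x y D ⊎ Covers w x y E)
  covers-++ w x y []      E = mk⇔ inj₂ (λ { (inj₁ ()) ; (inj₂ h) → h })
  covers-++ w x y (_ ∷ D) E = let r = covers-++ w x y D E in mk⇔
    (λ { (inj₁ h) → inj₁ (inj₁ h) ; (inj₂ h) → [ (λ h → inj₁ (inj₂ h)) , inj₂ ]′ (to r h) })
    (λ { (inj₁ (inj₁ h)) → inj₁ h ; (inj₁ (inj₂ h)) → inj₂ (from r (inj₁ h)) ; (inj₂ h) → inj₂ (from r (inj₂ h)) })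

  restrict : Modal × Modal → Rectangles → Rectangles
  restrict (α , β) []              = []
  restrict (α , β) ((α′ , β′) ∷ D) = (α ∧ α′ , β ∧ β′) ∷ restrict (α , β) D

  covers-restrict : ∀ w x y α β D →
    Covers w x y (restrict (α , β) D) ⇔ (((w , x ⊨ α) × (w , y ⊨ β)) × Covers w x y D)
  covers-restrict w x y α β []      = mk⇔ (λ ()) (λ ())
  covers-restrict w x y α β (_ ∷ D) = let r = covers-restrict w x y α β D in mk⇔
    (λ { (inj₁ ((a , a′) , (b , b′))) → (a , b) , inj₁ (a′ , b′)
       ; (inj₂ h) → let p , c = to r h in p , inj₂ c })
    (λ { ((a , b) , inj₁ (a′ , b′)) → inj₁ ((a , a′) , (b , b′)) ; (p , inj₂ c) → inj₂ (from r (p , c)) })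

  intersect : Rectangles → Rectangles → Rectangles
  intersect []      E = []
  intersect (r ∷ D) E = restrict r E ++ intersect D E

  covers-intersect : ∀ w x y D E → Covers w x y (intersect D E) ⇔ (Covers w x y D × Covers w x y E)
  covers-intersect w x y []            E = mk⇔ (λ ()) (λ ())
  covers-intersect w x y ((α , β) ∷ D) E = mk⇔
    (λ h → [ (λ h → let p , c = to (covers-restrict w x y α β E) h in inj₁ p , c)
           , (λ h → let p , c = to (covers-intersect w x y D E) h in inj₂ p , c) ]′
           (to (covers-++ w x y (restrict (α , β) E) _) h))
    (λ { (inj₁ p , c) → from (covers-++ w x y (restrict (α , β) E) _) (inj₁ (from (covers-restrict w x y α β E) (p , c)))
       ; (inj₂ p , c) → from (covers-++ w x y (restrict (α , β) E) _) (inj₂ (from (covers-intersect w x y D E) (p , c))) })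

  complement : Rectangles → Rectangles
  complement []            = (true , true) ∷ []
  complement ((α , β) ∷ D) = intersect ((not α , true) ∷ (true , not β) ∷ []) (complement D)

  covers-complement : ∀ w x y D → Covers w x y (complement D) ⇔ (¬ Covers w x y D)
  covers-complement w x y [] = mk⇔ (λ _ ()) (λ _ → inj₁ (tt , tt))
  covers-complement w x y ((α , β) ∷ D) = let r = covers-complement w x y D in mk⇔
    (λ h → let p , c = to (covers-intersect w x y _ (complement D)) h in
      λ { (inj₁ (a , b)) → outside-rectangle p a b ; (inj₂ i) → to r c i })
    (λ n → from (covers-intersect w x y _ (complement D)) (avoid (λ a b → n (inj₁ (a , b))) , from r (λ i → n (inj₂ i))))
    where
    outside-rectangle : Covers w x y ((not α , true) ∷ (true , not β) ∷ []) → (w , x ⊨ α) → (w , y ⊨ β) → ⊥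
    outside-rectangle (inj₁ (n , _))        a b = n a
    outside-rectangle (inj₂ (inj₁ (_ , n))) a b = n b
    avoid : ((w , x ⊨ α) → (w , y ⊨ β) → ⊥) → Covers w x y ((not α , true) ∷ (true , not β) ∷ [])
    avoid n with modal? w x α
    ... | yes a = inj₂ (inj₁ (tt , n a))
    ... | no ¬a = inj₁ (¬a , tt)

  transpose : Rectangles → Rectangles
  transpose []            = []
  transpose ((α , β) ∷ D) = (β , α) ∷ transpose D

  covers-transpose : ∀ w x y D → Covers w x y (transpose D) ⇔ Covers w y x D
  covers-transpose w x y []      = ⇔-refl
  covers-transpose w x y (_ ∷ D) = mk⇔ (λ { (a , b) → b , a }) (λ { (a , b) → b , a }) ⊎-⇔ covers-transpose w x y D

  project : Shape → Rectangles → Modal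
  project s []            = not true
  project s ((α , β) ∷ D) = (α ∧ ◇ s β) or project s D

  project-sat : ∀ s w x D → (w , x ⊨ project s D) ⇔ (Σ[ y ∈ Pos w ] (Holds s w x y × Covers w x y D))
  project-sat s w x []            = mk⇔ (λ n → ⊥-elim (n tt)) (λ { (_ , _ , ()) })
  project-sat s w x ((α , β) ∷ D) = mk⇔
    (λ h → [ (λ { (a , b) → let y , p , b = to (◇-sat s {w} {x} β) b in y , p , inj₁ (a , b) })
           , (λ h → let y , p , c = to (project-sat s w x D) h in y , p , inj₂ c) ]′ (to split h))
    (λ { (y , p , inj₁ (a , b)) → from split (inj₁ (a , from (◇-sat s {w} {x} β) (y , p , b)))
       ; (y , p , inj₂ c) → from split (inj₂ (from (project-sat s w x D) (y , p , c))) })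
    where
    split : (w , x ⊨ project s ((α , β) ∷ D)) ⇔ ((w , x ⊨ α ∧ ◇ s β) ⊎ (w , x ⊨ project s D))
    split = or-sat {w} {x} (α ∧ ◇ s β) (project s D)

  Relation : Set
  Relation = Shape → Rectangles

  -- The old value of the quantified name is forgotten, so the result constrains the other position
  -- only and is the same for all shapes. Quantifying the first name amounts to looking from the
  -- second position, hence the transposed rectangles and the mirrored shape.
  quantify : Fin 2 → Relation → Relation
  quantify zero    R _ = (true , some-shape (λ s → project s (transpose (R (mirror s))))) ∷ []
  quantify (suc _) R _ = (some-shape (λ s → project s (R s)) , true) ∷ []

  truth : Bool → Rectangles
  truth true  = (true , true) ∷ []
  truth false = []

  less : Fin 2 → Fin 2 → Shape → Bool
  less zero    (suc _) (apart fwd _ _) = true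
  less (suc _) zero    (apart bwd _ _) = true
  less _       _       _               = false

  equal : Fin 2 → Fin 2 → Shape → Bool
  equal zero    zero    _    = true
  equal (suc _) (suc _) _    = true
  equal _       _       same = true
  equal _       _       _    = false

  selects : A → Bool → Bool → Bool
  selects a b₀ b₁ with a ≟ a₀
  ... | yes _ = b₀
  ... | no _  = b₁

  contains : A → Fin 2 → Fin 2 → Shape → Bool
  contains a zero    (suc _) (apart fwd b₀ b₁) = selects a b₀ b₁
  contains a (suc _) zero    (apart bwd b₀ b₁) = selects a b₀ b₁
  contains a _       _       _                 = false

  has-letter : A → Fin 2 → Rectangles
  has-letter a zero    = (letter a , true) ∷ []
  has-letter a (suc _) = (true , letter a) ∷ []

  translate : ∀ {Γ} → FO²[<,Inv] A Γ → Relation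
  translate (_≺_ {x} {y} _ _)       s = truth (less x y s)
  translate (_≈_ {x} {y} _ _)       s = truth (equal x y s)
  translate (letter {x} a _)        s = has-letter a x
  translate (between {x} {y} a _ _) s = truth (contains a x y s)
  translate true                    s = truth true
  translate (not φ)                 s = complement (translate φ s)
  translate (φ ∧ ψ)                 s = intersect (translate φ s) (translate ψ s)
  translate (φ ∨ ψ)                 s = translate φ s ++ translate ψ s
  translate (∃′ x φ)                s = quantify x (translate φ) s
  translate (∀′ x φ)                s = complement (quantify x (λ s → complement (translate φ s)) s)

  pick : ∀ {X : Set} → Fin 2 → X → X → X
  pick zero    i j = i
  pick (suc _) i j = j

  -- Two positions are carried along even while a name is out of scope, where they are arbitrary. A
  -- sentence can thus be evaluated at any position of a nonempty word.
  Agrees : ∀ {Γ} (w : List A) → Env w Γ → Pos w → Pos w → Set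
  Agrees {Γ} w ρ i j = ∀ {x} (p : x ∈ Γ) → value ρ p ≡ pick x i j

  truth-sat : ∀ w i j {X} b → Occurs b X → X ⇔ Covers w i j (truth b)
  truth-sat w i j true  x = mk⇔ (λ _ → inj₁ (tt , tt)) (λ _ → x)
  truth-sat w i j false n = mk⇔ n (λ ())

  less-sat : ∀ w i j x y s → Holds s w i j → Occurs (less x y s) (pick x i j < pick y i j)
  less-sat w i j zero       zero       s               h    = <-irrefl refl
  less-sat w i j (suc _)    (suc _)    s               h    = <-irrefl refl
  less-sat w i j zero       (suc _)    same            refl = <-irrefl refl
  less-sat w i j zero       (suc _)    (apart fwd _ _) h    = proj₁ h
  less-sat w i j zero       (suc _)    (apart bwd _ _) h    = <-asym (proj₁ h)
  less-sat w i j (suc _)    zero       same            refl = <-irrefl refl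
  less-sat w i j (suc _)    zero       (apart fwd _ _) h    = <-asym (proj₁ h)
  less-sat w i j (suc _)    zero       (apart bwd _ _) h    = proj₁ h

  equal-sat : ∀ w i j x y s → Holds s w i j → Occurs (equal x y s) (pick x i j ≡ pick y i j)
  equal-sat w i j zero       zero       s               h = refl
  equal-sat w i j (suc _)    (suc _)    s               h = refl
  equal-sat w i j zero       (suc _)    same            h = h
  equal-sat w i j zero       (suc _)    (apart d _ _)   h = λ { refl → lt-irrefl d (proj₁ h) }
  equal-sat w i j (suc _)    zero       same            h = sym h
  equal-sat w i j (suc _)    zero       (apart d _ _)   h = λ { refl → lt-irrefl d (proj₁ h) }

  selects-sat : ∀ d w i j a b₀ b₁ → Occurs b₀ (Has d a₀ w i j) → Occurs b₁ (Has d a₁ w i j) →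
    Occurs (selects a b₀ b₁) (Has d a w i j)
  selects-sat d w i j a b₀ b₁ h₀ h₁ with a ≟ a₀ | two a
  ... | yes refl | _         = h₀
  ... | no n     | inj₁ e    = contradiction e n
  ... | no n     | inj₂ refl = h₁

  has⇒lt : ∀ d {a} w {x y} → Has d a w x y → lt d x y
  has⇒lt d w (z , p , q , _) = lt-trans d p q

  contains-sat : ∀ w i j a x y s → Holds s w i j → Occurs (contains a x y s) (Has fwd a w (pick x i j) (pick y i j))
  contains-sat w i j a zero    zero    s    h    r = <-irrefl refl (has⇒lt fwd w {i} {i} r)
  contains-sat w i j a (suc _) (suc _) s    h    r = <-irrefl refl (has⇒lt fwd w {j} {j} r)
  contains-sat w i j a zero    (suc _) same refl r = <-irrefl refl (has⇒lt fwd w {i} {i} r)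
  contains-sat w i j a (suc _) zero    same refl r = <-irrefl refl (has⇒lt fwd w {i} {i} r)
  contains-sat w i j a zero    (suc _) (apart fwd b₀ b₁) (l , h₀ , h₁) = selects-sat fwd w i j a b₀ b₁ h₀ h₁
  contains-sat w i j a zero    (suc _) (apart bwd b₀ b₁) (l , _) r = <-asym l (has⇒lt fwd w {i} {j} r)
  contains-sat w i j a (suc _) zero    (apart fwd b₀ b₁) (l , _) r = <-asym l (has⇒lt fwd w {j} {i} r)
  contains-sat w i j a (suc _) zero    (apart bwd b₀ b₁) (l , h₀ , h₁) =
    occurs-⇔ (selects a b₀ b₁) (has-op bwd a w i j) (selects-sat bwd w i j a b₀ b₁ h₀ h₁)

  letter-sat : ∀ w i j a x → (lookup w (pick x i j) ≡ a) ⇔ Covers w i j (has-letter a x)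
  letter-sat w i j a zero    = mk⇔ (λ e → inj₁ (e , tt)) (λ { (inj₁ (e , _)) → e ; (inj₂ ()) })
  letter-sat w i j a (suc _) = mk⇔ (λ e → inj₁ (tt , e)) (λ { (inj₁ (_ , e)) → e ; (inj₂ ()) })

  quantify-sat : ∀ w x R i j s →
    Covers w i j (quantify x R s) ⇔
    (Σ[ k ∈ Pos w ] Σ[ s ∈ Shape ] (let i′ = pick x k i ; j′ = pick x j k in Holds s w i′ j′ × Covers w i′ j′ (R s)))
  quantify-sat w zero R i j s = mk⇔
    (λ { (inj₁ (_ , h)) →
           let t , h = to (some-shape-sat w j f) h
               k , p , c = to (project-sat t w j (transpose (R (mirror t)))) h
           in k , mirror t , mirrored t w j k p , to (covers-transpose w j k (R (mirror t))) c
       ; (inj₂ ()) })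
    (λ { (k , s , p , c) → inj₁ (tt , from (some-shape-sat w j f) (mirror s
           , from (project-sat (mirror s) w j (transpose (R (mirror (mirror s))))) (k , mirrored s w k j p
           , from (covers-transpose w j k (R (mirror (mirror s))))
               (subst (λ s → Covers w k j (R s)) (sym (mirror-mirror s)) c)))) })
    where
    f : Shape → Modal
    f s = project s (transpose (R (mirror s)))
    mirror-mirror : ∀ s → mirror (mirror s) ≡ s
    mirror-mirror same              = refl
    mirror-mirror (apart fwd b₀ b₁) = refl
    mirror-mirror (apart bwd b₀ b₁) = refl
  quantify-sat w (suc _) R i j s = mk⇔
    (λ { (inj₁ (h , _)) →
           let t , h = to (some-shape-sat w i f) h
               k , p , c = to (project-sat t w i (R t)) h
           in k , t , p , c
       ; (inj₂ ()) })
    (λ { (k , s , p , c) → inj₁ (from (some-shape-sat w i f) (s , from (project-sat s w i (R s)) (k , p , c)) , tt) })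
    where
    f : Shape → Modal
    f s = project s (R s)

  quantified : ∀ w x i j s R {S : Pos w → Set} →
    (∀ k t → Holds t w (pick x k i) (pick x j k) → S k ⇔ Covers w (pick x k i) (pick x j k) (R t)) →
    (Σ[ k ∈ Pos w ] S k) ⇔ Covers w i j (quantify x R s)
  quantified w x i j s R h = mk⇔
    (λ { (k , y) → let t , c = shape w (pick x k i) (pick x j k) in
         from (quantify-sat w x R i j s) (k , t , c , to (h k t c) y) })
    (λ y → let k , t , c , y = to (quantify-sat w x R i j s) y in k , from (h k t c) y)

  assigned : ∀ {Γ} (w : List A) (ρ : Env w Γ) i j x k → Agrees w ρ i j →
    Agrees w (assign ρ x k) (pick x k i) (pick x j k)
  assigned w (_ ∷ _ ∷ []) i j zero       k h here         = refl
  assigned w (_ ∷ _ ∷ []) i j zero       k h (there here) = h (there here)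
  assigned w (_ ∷ _ ∷ []) i j (suc zero) k h here         = h here
  assigned w (_ ∷ _ ∷ []) i j (suc zero) k h (there here) = refl

  -- The shape decides all binary atoms and a single position decides each letter atom, so for a
  -- fixed shape the two positions do not interact any further and rectangles suffice. The universal
  -- quantifier is treated as the dual of the existential one, by decidability of `Covers`.
  translate-sat : ∀ {Γ} (φ : FO²[<,Inv] A Γ) w (ρ : Env w Γ) i j s → Agrees w ρ i j → Holds s w i j →
    Sat² w ρ φ ⇔ Covers w i j (translate φ s)
  translate-sat (_≺_ {x} {y} p q) w ρ i j s h c = truth-sat w i j (less x y s) (less-sat w i j x y s c)
    ⇔-∘ ≡⇒⇔ (cong₂ _<_ (h p) (h q))
  translate-sat (_≈_ {x} {y} p q) w ρ i j s h c = truth-sat w i j (equal x y s) (equal-sat w i j x y s c)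
    ⇔-∘ ≡⇒⇔ (cong₂ _≡_ (h p) (h q))
  translate-sat (letter {x} a p) w ρ i j s h c = letter-sat w i j a x
    ⇔-∘ ≡⇒⇔ (cong (λ z → lookup w z ≡ a) (h p))
  translate-sat (between {x} {y} a p q) w ρ i j s h c = truth-sat w i j (contains a x y s) (contains-sat w i j a x y s c)
    ⇔-∘ ≡⇒⇔ (cong₂ (Has fwd a w) (h p) (h q))
  translate-sat true    w ρ i j s h c = truth-sat w i j true tt
  translate-sat (not φ) w ρ i j s h c =
    ⇔-sym (covers-complement w i j (translate φ s)) ⇔-∘ ¬-⇔ (translate-sat φ w ρ i j s h c)
  translate-sat (φ ∧ ψ) w ρ i j s h c = ⇔-sym (covers-intersect w i j (translate φ s) (translate ψ s))
    ⇔-∘ (translate-sat φ w ρ i j s h c ×-⇔ translate-sat ψ w ρ i j s h c)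
  translate-sat (φ ∨ ψ) w ρ i j s h c = ⇔-sym (covers-++ w i j (translate φ s) (translate ψ s))
    ⇔-∘ (translate-sat φ w ρ i j s h c ⊎-⇔ translate-sat ψ w ρ i j s h c)
  translate-sat (∃′ x φ) w ρ i j s h c = quantified w x i j s (translate φ)
    λ k t → translate-sat φ w (assign ρ x k) _ _ t (assigned w ρ i j x k h)
  translate-sat (∀′ x φ) w ρ i j s h c =
    ⇔-sym (covers-complement w i j (quantify x (λ t → complement (translate φ t)) s))
    ⇔-∘ (¬-⇔ (quantified w x i j s (λ t → complement (translate φ t)) λ k t c → ⇔-sym (covers-complement w _ _ (translate φ t))
               ⇔-∘ ¬-⇔ (translate-sat φ w (assign ρ x k) _ _ t (assigned w ρ i j x k h) c))
    ⇔-∘ mk⇔ (λ { f (k , n) → n (f k) }) λ n k →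
      let t , c = shape w (pick x k i) (pick x j k)
          r = translate-sat φ w (assign ρ x k) _ _ t (assigned w ρ i j x k h) c
      in from r (decidable-stable (covers? w _ _ (translate φ t)) λ m → n (k , λ y → m (to r y))))

  -- The Σ₃ sentence.

  close : ∀ n → FO[<] A n → FO[<] A 0
  close zero    φ = φ
  close (suc n) φ = close n (∃′ φ)

  close-Σ : ∀ n {φ : FO[<] A n} → IsΣ (suc k) φ → IsΣ (suc k) (close n φ)
  close-Σ zero    p = p
  close-Σ (suc n) p = close-Σ n (∃′ p)

  close-sat : ∀ n (φ : FO[<] A n) w → Sat w [] (close n φ) ⇔ (Σ[ ρ ∈ Vec (Pos w) n ] Sat w ρ φ)
  close-sat zero    φ w = mk⇔ (λ s → [] , s) (λ { ([] , s) → s })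
  close-sat (suc n) φ w = mk⇔ (λ { (ρ , i , s) → i ∷ ρ , s }) (λ { (i ∷ ρ , s) → ρ , i , s }) ⇔-∘ close-sat n (∃′ φ) w

  -- The parameters and the position `x` are guessed in one existential block, and what remains is a
  -- conjunction of Π₂ conditions. Since `x` is always among the guessed positions, the sentence
  -- fails in the empty word.
  modal-Σ₃ : ∀ α → Σ[ ψ ∈ FO[<] A 0 ] (IsΣ 3 ψ × ¬ ⟦ ψ ⟧ [] × (∀ w → Pos w → ⟦ ψ ⟧ w ⇔ (Σ[ x ∈ Pos w ] (w , x ⊨ α))))
  modal-Σ₃ α = close (suc arity) (formula body) , close-Σ (suc arity) (is body) , nonempty
    , λ w o → mk⇔
      (λ s → let ρ , s = to (close-sat (suc arity) (formula body) w) s in found w ρ (from (defines body w o ρ) s))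
      (λ { (x , h) → let ρ , P = exists w o in
           from (close-sat (suc arity) (formula body) w)
             (x ∷ ρ , to (defines body w o (x ∷ ρ)) (P , to (correct w ρ x P) h)) })
    where
    open Eliminated (eliminate α)
    Body : Predicate (suc arity)
    Body w ρ = Params w (tail ρ) × At-head Property w ρ
    body : Def σ 3 Body
    body = raised π σ (renᵈ {P = Params} suc (λ w → tail) (λ { w (x ∷ ρ) i → refl }) params-def ∧ᵈ yes-defᵖ is-local)
    found : ∀ w ρ → Body w ρ → Σ[ x ∈ Pos w ] (w , x ⊨ α)
    found w (x ∷ ρ) (P , h) = x , from (correct w ρ x P) h
    nonempty : ¬ ⟦ close (suc arity) (formula body) ⟧ []
    nonempty s with to (close-sat (suc arity) (formula body) []) s
    ... | () ∷ _ , _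

  -- A sentence has no name in scope, so its modal translation holds at all positions of a nonempty
  -- word or at none, and the existence of one such position decides membership. The empty word is
  -- added or left out by a second disjunct.
  FO²⇒BΣ₃ : ∀ {L : Language A} → DefinableFO² L → AlternationDepth≤ L 3
  FO²⇒BΣ₃ {L} D@(φ , f , g) = 3 , defined , ℕₚ.≤-refl
    where
    α : Modal
    α = project same (translate φ same)
    sound : ∀ w x → (w , x ⊨ α) ⇔ L w
    sound w x = mk⇔
      (λ h → let y , p , c = to (project-sat same w x (translate φ same)) h in
        g (from (translate-sat φ w (tt ∷ tt ∷ []) x y same none p) c))
      (λ l → from (project-sat same w x (translate φ same))
        (x , refl , to (translate-sat φ w (tt ∷ tt ∷ []) x x same none refl) (f l)))
      where
      none : ∀ {i j} → Agrees w (tt ∷ tt ∷ []) i j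
      none (there (there ()))
    empty? : Dec (L [])
    empty? = let ψ , f′ , g′ = FO²⇒FO D in map′ g′ f′ (sat? [] [] ψ)
    on-empty-word : Σ[ χ ∈ FO[<] A 0 ] (IsΣ 3 χ × (⟦ χ ⟧ [] ⇔ L []) × (∀ w → Pos w → ¬ ⟦ χ ⟧ w))
    on-empty-word with empty?
    -- A universal quantifier over a false matrix holds in the empty word alone; the outer
    -- existential block is empty.
    ... | yes l = ∀′ (not true) , block (∀′ (block (block (qf (not true)))))
      , mk⇔ (λ _ → l) (λ _ ()) , λ w o s → s o tt
    ... | no n  = not true , block (block (block (qf (not true)))) , mk⇔ (λ s → ⊥-elim (s tt)) (λ l → ⊥-elim (n l))
      , λ w o s → s tt
    defined : DefinableBΣ 3 L
    defined with modal-Σ₃ α | on-empty-word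
    ... | ψ , p , not-empty , e | χ , q , e′ , not-nonempty = ψ ∨ χ , base p ∨ base q , forwards , backwards
      where
      forwards : ∀ {w} → L w → ⟦ ψ ∨ χ ⟧ w
      forwards {[]}    l = inj₂ (from e′ l)
      forwards {a ∷ w} l = inj₁ (from (e (a ∷ w) zero) (zero , from (sound (a ∷ w) zero) l))
      backwards : ∀ {w} → ⟦ ψ ∨ χ ⟧ w → L w
      backwards {[]}    (inj₁ s) = ⊥-elim (not-empty s)
      backwards {a ∷ w} (inj₁ s) = let x , h = to (e (a ∷ w) zero) s in to (sound (a ∷ w) x) h
      backwards {[]}    (inj₂ s) = to e′ s
      backwards {a ∷ w} (inj₂ s) = ⊥-elim (not-nonempty (a ∷ w) zero s)

binary-bound : (A : Set) → A ↔ Fin 2 → (L : Language A) → DefinableFO² L → AlternationDepth≤ L 3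
binary-bound A A↔2 L D = Binary.FO²⇒BΣ₃ _≟_ (Inverse.from A↔2 zero) (Inverse.from A↔2 (suc zero)) distinct two D
  where
  open Inverse A↔2 using ()
    renaming (to to code; from to decode; strictlyInverseˡ to code-decode; strictlyInverseʳ to decode-code)
  _≟_ : DecidableEquality A
  a ≟ b = map′ (λ e → trans (sym (decode-code a)) (trans (cong decode e) (decode-code b))) (cong code) (code a ≟ᶠ code b)
  distinct : decode zero ≢ decode (suc zero)
  distinct e with trans (sym (code-decode zero)) (trans (cong code e) (code-decode (suc zero)))
  ... | ()
  two : ∀ a → a ≡ decode zero ⊎ a ≡ decode (suc zero)
  two a with code a in e
  ... | zero     = inj₁ (trans (sym (decode-code a)) (cong decode e))
  ... | suc zero = inj₂ (trans (sym (decode-code a)) (cong decode e))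

theorem8 : ((d : ℕ) → Σ[ n ∈ ℕ ] Σ[ L ∈ Language (Fin n) ] (DefinableFO² L × AlternationDepth> L d))
    × ((A : Set) → A ↔ Fin 2 → (L : Language A) → DefinableFO² L → AlternationDepth≤ L 3)
theorem8 = hierarchy , binary-bound
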